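{- Let $\Phi=(D,\varphi)$ be a $\mathbb{T}$-gain digraph where $D$ is strongly connected. Then the following are equivalent: (i) $\Phi$ is cycle balanced. (ii) $\Phi\sim(D,\mathbf{1})$, i.e., $\Phi$ has a potential function. (iii) $A(\Phi)$ is cospectral with $A(D)$.
   Context: A digraph $D=(V,\mathcal{A})$ has a finite vertex set $V=\{v_1,\dots,v_n\}$ and a set $\mathcal{A}$ of ordered pairs of distinct vertices, called arcs (no loops; at most one arc from $v_i$ to $v_j$ for each ordered pair; opposite arcs may both be present). A directed cycle is a closed directed walk whose vertices are distinct except that the first and last coincide (so its length is at least $2$; length $2$ is allowed). $D$ is strongly connected if every ordered pair of vertices is joined by a directed path. Let $\mathbb{T}=\{z\in\mathbb{C}:|z|=1\}$. A $\mathbb{T}$-gain digraph is a pair $\Phi=(D,\varphi)$ with $\varphi:\mathcal{A}\to\mathbb{T}$ an arbitrary function (no relation between gains of opposite arcs). Its gain adjacency matrix $A(\Phi)$ has entries $A(\Phi)_{ij}=\varphi(v_i,v_j)$ if $(v_i,v_j)\in\mathcal{A}$ and $0$ otherwise; $A(D)$ is the $0/1$ adjacency matrix of $D$ ($A(D)_{ij}=1$ iff $(v_i,v_j)\in\mathcal{A}$). The gain $\varphi(C)$ of a directed cycle is the product of the gains of its arcs; $\Phi$ is cycle balanced if $\varphi(C)=1$ for every directed cycle $C$ of $D$. For $\sigma:V\to\mathbb{T}$, the switching of $\Phi$ by $\sigma$ is $\Phi^\sigma=(D,\varphi^\sigma)$ with $\varphi^\sigma(v_i,v_j)=\sigma(v_i)\varphi(v_i,v_j)\overline{\sigma(v_j)}$.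 Two $\mathbb{T}$-gain digraphs $\Phi,\Phi'$ on the same $D$ are switching equivalent, $\Phi\sim\Phi'$, if $\Phi'=\Phi^\sigma$ for some $\sigma$. $(D,\mathbf{1})$ denotes $D$ with every arc given gain $1$. A potential function for $\varphi$ is a map $\psi:V\to\mathbb{T}$ with $\varphi(v_i,v_j)=\overline{\psi(v_i)}\,\psi(v_j)$ for every arc $(v_i,v_j)$; its existence means exactly $\Phi\sim(D,\mathbf{1})$. Two matrices are cospectral if they have the same characteristic polynomial. -}

module Defs where

open import Algebra.Bundles using (CommutativeRing)
open import Algebra.Bundles.Raw using (RawRing)
import Algebra.Definitions.RawMonoid as RawMonoidOps
import Algebra.Definitions.RawSemiring as RawSemiringOps
open import Data.Bool.Base using (Bool; if_then_else_; T)
open import Data.Bool.Properties using (T?)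
open import Data.Fin.Base using (Fin; zero; suc; toℕ; punchIn)
import Data.Fin.Properties as Fin
open import Data.List.Base using (List; []; _∷_; map)
open import Data.List.Relation.Unary.Unique.Propositional using (Unique)
open import Data.Nat.Base using (ℕ; zero; suc; _⊔_)
import Data.Nat.Base as ℕ
import Data.Nat.Properties as ℕ
open import Data.Product.Base using (Σ; ∃; _×_; _,_)
open import Data.Rational.Base using (ℚ; 0ℚ; 1ℚ; ½; ∣_∣)
import Data.Rational.Base as ℚ
import Data.Rational.Properties as ℚ
open import Data.Rational.Solver using (module +-*-Solver)
open import Level using (0ℓ)
open import Relation.Binary.Construct.Closure.ReflexiveTransitive using (Star; _◅_)
  renaming (ε to nil)
open import Relation.Binary.PropositionalEquality
  using (_≡_; refl; sym; trans; cong; cong₂; subst; subst₂)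
open import Relation.Binary.Structures using (IsEquivalence)
open import Relation.Nullary using (¬_; yes; no)
open import Relation.Nullary.Decidable using (⌊_⌋)

open +-*-Solver using (solve; _:+_; _:*_; :-_; _:-_; _:=_; con)

------------------------------------------------------------------------
-- Real numbers, as Cauchy sequences of rationals

-- Two sequences are related when their terms become arbitrarily close.
-- "x ∼ˢ x" is the Cauchy condition, and between Cauchy sequences
-- "x ∼ˢ y" says that x − y tends to 0.

infix 4 _∼ˢ_

record _∼ˢ_ (x y : ℕ → ℚ) : Set where
  field
    within : ∀ ε → 0ℚ ℚ.< ε →
      ∃ λ N → ∀ m n → N ℕ.≤ m → N ℕ.≤ n → ∣ x m ℚ.- y n ∣ ℚ.< ε

open _∼ˢ_ public

private

  variable
    x y z x′ y′ : ℕ → ℚ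

  half-pos : ∀ {ε} → 0ℚ ℚ.< ε → 0ℚ ℚ.< ½ ℚ.* ε
  half-pos {ε} 0<ε = subst (ℚ._< ½ ℚ.* ε) (ℚ.*-zeroʳ ½) (ℚ.*-monoʳ-<-pos ½ 0<ε)

  half+half : ∀ ε → ½ ℚ.* ε ℚ.+ ½ ℚ.* ε ≡ ε
  half+half ε = trans (sym (ℚ.*-distribʳ-+ ε ½ ½)) (ℚ.*-identityˡ ε)

  triangle : ∀ {δ₁ δ₂} p q → ∣ p ∣ ℚ.< δ₁ → ∣ q ∣ ℚ.< δ₂ → ∣ p ℚ.+ q ∣ ℚ.< δ₁ ℚ.+ δ₂
  triangle p q p< q< = ℚ.≤-<-trans (ℚ.∣p+q∣≤∣p∣+∣q∣ p q) (ℚ.+-mono-< p< q<)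

  ∼ˢ-sym : x ∼ˢ y → y ∼ˢ x
  ∼ˢ-sym {x} {y} x∼y .within ε 0<ε with within x∼y ε 0<ε
  ... | N , close = N , λ m n N≤m N≤n →
    subst (ℚ._< ε) (trans (sym (ℚ.∣-p∣≡∣p∣ _)) (cong ∣_∣ (flip (x n) (y m)))) (close n m N≤n N≤m)
    where
    flip : ∀ p q → ℚ.- (p ℚ.- q) ≡ q ℚ.- p
    flip = solve 2 (λ p q → :- (p :- q) := q :- p) refl

  ∼ˢ-trans : x ∼ˢ y → y ∼ˢ z → x ∼ˢ z
  ∼ˢ-trans {x} {y} {z} x∼y y∼z .within ε 0<ε
    with within x∼y (½ ℚ.* ε) (half-pos 0<ε) | within y∼z (½ ℚ.* ε) (half-pos 0<ε)
  ... | N₁ , close₁ | N₂ , close₂ = N₁ ⊔ N₂ , λ m n N≤m N≤n →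
    let k = N₁ ⊔ N₂ in
    subst₂ ℚ._<_ (cong ∣_∣ (telescope (x m) (y k) (z n))) (half+half ε)
      (triangle (x m ℚ.- y k) (y k ℚ.- z n)
        (close₁ m k (ℕ.m⊔n≤o⇒m≤o N₁ N₂ N≤m) (ℕ.m≤m⊔n N₁ N₂))
        (close₂ k n (ℕ.m≤n⊔m N₁ N₂) (ℕ.m⊔n≤o⇒n≤o N₁ N₂ N≤n)))
    where
    telescope : ∀ p q r → (p ℚ.- q) ℚ.+ (q ℚ.- r) ≡ p ℚ.- r
    telescope = solve 3 (λ p q r → (p :- q) :+ (q :- r) := p :- r) refl

  ≗⇒∼ˢ : x ∼ˢ x → (∀ n → x n ≡ y n) → x ∼ˢ y
  ≗⇒∼ˢ {x} x∼x x≗y .within ε 0<ε with within x∼x ε 0<ε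
  ... | N , close = N , λ m n N≤m N≤n →
    subst (λ q → ∣ x m ℚ.- q ∣ ℚ.< ε) (x≗y n) (close m n N≤m N≤n)

  const-cauchy : ∀ q → (λ _ → q) ∼ˢ (λ _ → q)
  const-cauchy q .within ε 0<ε = 0 , λ _ _ _ _ →
    subst (λ r → ∣ r ∣ ℚ.< ε) (sym (ℚ.+-inverseʳ q)) 0<ε

  +-∼ˢ : x ∼ˢ x′ → y ∼ˢ y′ → (λ n → x n ℚ.+ y n) ∼ˢ (λ n → x′ n ℚ.+ y′ n)
  +-∼ˢ {x} {x′} {y} {y′} x∼x′ y∼y′ .within ε 0<ε
    with within x∼x′ (½ ℚ.* ε) (half-pos 0<ε) | within y∼y′ (½ ℚ.* ε) (half-pos 0<ε)
  ... | N₁ , close₁ | N₂ , close₂ = N₁ ⊔ N₂ , λ m n N≤m N≤n →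
    subst₂ ℚ._<_ (cong ∣_∣ (regroup (x m) (x′ n) (y m) (y′ n))) (half+half ε)
      (triangle (x m ℚ.- x′ n) (y m ℚ.- y′ n)
        (close₁ m n (ℕ.m⊔n≤o⇒m≤o N₁ N₂ N≤m) (ℕ.m⊔n≤o⇒m≤o N₁ N₂ N≤n))
        (close₂ m n (ℕ.m⊔n≤o⇒n≤o N₁ N₂ N≤m) (ℕ.m⊔n≤o⇒n≤o N₁ N₂ N≤n)))
    where
    regroup : ∀ p p′ q q′ → (p ℚ.- p′) ℚ.+ (q ℚ.- q′) ≡ (p ℚ.+ q) ℚ.- (p′ ℚ.+ q′)
    regroup = solve 4 (λ p p′ q q′ → (p :- p′) :+ (q :- q′) := (p :+ q) :- (p′ :+ q′)) refl

  -‿∼ˢ : x ∼ˢ x′ → (λ n → ℚ.- x n) ∼ˢ (λ n → ℚ.- x′ n)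
  -‿∼ˢ {x} {x′} x∼x′ .within ε 0<ε with within x∼x′ ε 0<ε
  ... | N , close = N , λ m n N≤m N≤n →
    subst (ℚ._< ε) (trans (sym (ℚ.∣-p∣≡∣p∣ _)) (cong ∣_∣ (distrib (x m) (x′ n)))) (close m n N≤m N≤n)
    where
    distrib : ∀ p q → ℚ.- (p ℚ.- q) ≡ (ℚ.- p) ℚ.- (ℚ.- q)
    distrib = solve 2 (λ p q → :- (p :- q) := (:- p) :- (:- q)) refl

  bounded : x ∼ˢ y → ∃ λ B → ℚ.Positive B × ∃ λ N → ∀ m → N ℕ.≤ m → ∣ x m ∣ ℚ.≤ B
  bounded {x} {y} x∼y with within x∼y 1ℚ (ℚ.positive⁻¹ 1ℚ)
  ... | N , close = 1ℚ ℚ.+ ∣ y N ∣ , ℚ.pos+nonNeg⇒pos 1ℚ ∣ y N ∣ {{ℚ.∣-∣-nonNeg (y N)}} , N , λ m N≤m →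
    subst (ℚ._≤ 1ℚ ℚ.+ ∣ y N ∣) (cong ∣_∣ (cancel (x m) (y N)))
      (ℚ.≤-trans (ℚ.∣p+q∣≤∣p∣+∣q∣ (x m ℚ.- y N) (y N))
        (ℚ.+-monoˡ-≤ ∣ y N ∣ (ℚ.<⇒≤ (close m N N≤m ℕ.≤-refl))))
    where
    cancel : ∀ p q → (p ℚ.- q) ℚ.+ q ≡ p
    cancel = solve 2 (λ p q → (p :- q) :+ q := p) refl

  shrink : ∀ B → ℚ.Positive B → ∀ {ε} → 0ℚ ℚ.< ε → ∃ λ δ → 0ℚ ℚ.< δ × B ℚ.* δ ≡ ε
  shrink B B>0 {ε} 0<ε = B⁻¹ ℚ.* ε
    , subst (ℚ._< B⁻¹ ℚ.* ε) (ℚ.*-zeroʳ B⁻¹) (ℚ.*-monoʳ-<-pos B⁻¹ {{ℚ.1/pos⇒pos B}} 0<ε)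
    , trans (sym (ℚ.*-assoc B B⁻¹ ε)) (trans (cong (ℚ._* ε) (ℚ.*-inverseʳ B)) (ℚ.*-identityˡ ε))
    where
    instance
      B-pos : ℚ.Positive B
      B-pos = B>0
      B-nonZero : ℚ.NonZero B
      B-nonZero = ℚ.pos⇒nonZero B
    B⁻¹ : ℚ
    B⁻¹ = ℚ.1/ B

  bound-* : ∀ {B δ} p q → ℚ.Positive B → ∣ p ∣ ℚ.≤ B → ∣ q ∣ ℚ.< δ → ∣ p ℚ.* q ∣ ℚ.< B ℚ.* δ
  bound-* {B} {δ} p q B>0 p≤B q<δ =
    subst (ℚ._< B ℚ.* δ) (sym (ℚ.∣p*q∣≡∣p∣*∣q∣ p q))
      (ℚ.≤-<-trans (ℚ.*-monoʳ-≤-nonNeg ∣ q ∣ {{ℚ.∣-∣-nonNeg q}} p≤B)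
        (ℚ.*-monoʳ-<-pos B {{B>0}} q<δ))

  *-estimate : ∀ {ε B C δ η} p p′ q q′ → ℚ.Positive B → ℚ.Positive C →
    B ℚ.* δ ≡ ½ ℚ.* ε → C ℚ.* η ≡ ½ ℚ.* ε →
    ∣ p ∣ ℚ.≤ B → ∣ q ℚ.- q′ ∣ ℚ.< δ → ∣ q′ ∣ ℚ.≤ C → ∣ p ℚ.- p′ ∣ ℚ.< η →
    ∣ p ℚ.* q ℚ.- p′ ℚ.* q′ ∣ ℚ.< ε
  *-estimate {ε} p p′ q q′ B>0 C>0 Bδ Cη p≤B q∼q′ q′≤C p∼p′ =
    subst₂ ℚ._<_ (cong ∣_∣ (regroup p p′ q q′)) (trans (cong₂ ℚ._+_ Bδ Cη) (half+half ε))
      (triangle (p ℚ.* (q ℚ.- q′)) (q′ ℚ.* (p ℚ.- p′))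
        (bound-* p (q ℚ.- q′) B>0 p≤B q∼q′)
        (bound-* q′ (p ℚ.- p′) C>0 q′≤C p∼p′))
    where
    regroup : ∀ p p′ q q′ →
      p ℚ.* (q ℚ.- q′) ℚ.+ q′ ℚ.* (p ℚ.- p′) ≡ p ℚ.* q ℚ.- p′ ℚ.* q′
    regroup = solve 4 (λ p p′ q q′ → p :* (q :- q′) :+ q′ :* (p :- p′) := p :* q :- p′ :* q′) refl

  *-∼ˢ : x ∼ˢ x′ → y ∼ˢ y′ → (λ n → x n ℚ.* y n) ∼ˢ (λ n → x′ n ℚ.* y′ n)
  *-∼ˢ {x} {x′} {y} {y′} x∼x′ y∼y′ .within ε 0<ε =
    let
      B , B>0 , N₁ , x≤B  = bounded x∼x′
      C , C>0 , N₂ , y′≤C = bounded (∼ˢ-sym y∼y′)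
      δ , 0<δ , Bδ        = shrink B B>0 (half-pos 0<ε)
      η , 0<η , Cη        = shrink C C>0 (half-pos 0<ε)
      N₃ , close₃         = within y∼y′ δ 0<δ
      N₄ , close₄         = within x∼x′ η 0<η
      split : ∀ {k} → (N₁ ⊔ N₂) ⊔ (N₃ ⊔ N₄) ℕ.≤ k → (N₁ ℕ.≤ k × N₂ ℕ.≤ k) × (N₃ ℕ.≤ k × N₄ ℕ.≤ k)
      split N≤k =
        let N₁₂ = ℕ.m⊔n≤o⇒m≤o (N₁ ⊔ N₂) (N₃ ⊔ N₄) N≤k
            N₃₄ = ℕ.m⊔n≤o⇒n≤o (N₁ ⊔ N₂) (N₃ ⊔ N₄) N≤k
        in (ℕ.m⊔n≤o⇒m≤o N₁ N₂ N₁₂ , ℕ.m⊔n≤o⇒n≤o N₁ N₂ N₁₂)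
         , (ℕ.m⊔n≤o⇒m≤o N₃ N₄ N₃₄ , ℕ.m⊔n≤o⇒n≤o N₃ N₄ N₃₄)
    in
    (N₁ ⊔ N₂) ⊔ (N₃ ⊔ N₄) , λ m n N≤m N≤n →
    let
      (m₁ , m₂) , (m₃ , m₄) = split N≤m
      (n₁ , n₂) , (n₃ , n₄) = split N≤n
    in
    *-estimate {ε} {B} {C} {δ} {η} (x m) (x′ n) (y m) (y′ n) B>0 C>0 Bδ Cη
      (x≤B m m₁) (close₃ m n m₃ n₃) (y′≤C n n₂) (close₄ m n m₄ n₄)

-- Without η, unification compares real and complex expressions by their
-- operations instead of unfolding them to sequences.

record ℝ : Set where
  no-eta-equality
  field
    seq    : ℕ → ℚ
    cauchy : seq ∼ˢ seq

open ℝ public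

infix  4 _≈ᴿ_
infixl 6 _+ᴿ_ _-ᴿ_
infixl 7 _*ᴿ_
infix  8 -ᴿ_

record _≈ᴿ_ (a b : ℝ) : Set where
  constructor mk≈ᴿ
  field
    approach : seq a ∼ˢ seq b

open _≈ᴿ_ public

0ᴿ 1ᴿ : ℝ
0ᴿ .seq _  = 0ℚ
0ᴿ .cauchy = const-cauchy 0ℚ
1ᴿ .seq _  = 1ℚ
1ᴿ .cauchy = const-cauchy 1ℚ

_+ᴿ_ _*ᴿ_ : ℝ → ℝ → ℝ
(a +ᴿ b) .seq n  = seq a n ℚ.+ seq b n
(a +ᴿ b) .cauchy = +-∼ˢ (cauchy a) (cauchy b)
(a *ᴿ b) .seq n  = seq a n ℚ.* seq b n
(a *ᴿ b) .cauchy = *-∼ˢ (cauchy a) (cauchy b)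

-ᴿ_ : ℝ → ℝ
(-ᴿ a) .seq n  = ℚ.- seq a n
(-ᴿ a) .cauchy = -‿∼ˢ (cauchy a)

_-ᴿ_ : ℝ → ℝ → ℝ
a -ᴿ b = a +ᴿ (-ᴿ b)

≈ᴿ-isEquivalence : IsEquivalence _≈ᴿ_
≈ᴿ-isEquivalence = record
  { refl  = λ {a} → mk≈ᴿ (cauchy a)
  ; sym   = λ (mk≈ᴿ p) → mk≈ᴿ (∼ˢ-sym p)
  ; trans = λ (mk≈ᴿ p) (mk≈ᴿ q) → mk≈ᴿ (∼ˢ-trans p q)
  }

+ᴿ-cong : ∀ {a a′ b b′} → a ≈ᴿ a′ → b ≈ᴿ b′ → a +ᴿ b ≈ᴿ a′ +ᴿ b′
+ᴿ-cong (mk≈ᴿ p) (mk≈ᴿ q) = mk≈ᴿ (+-∼ˢ p q)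

*ᴿ-cong : ∀ {a a′ b b′} → a ≈ᴿ a′ → b ≈ᴿ b′ → a *ᴿ b ≈ᴿ a′ *ᴿ b′
*ᴿ-cong (mk≈ᴿ p) (mk≈ᴿ q) = mk≈ᴿ (*-∼ˢ p q)

-ᴿ-cong : ∀ {a a′} → a ≈ᴿ a′ → -ᴿ a ≈ᴿ -ᴿ a′
-ᴿ-cong (mk≈ᴿ p) = mk≈ᴿ (-‿∼ˢ p)

≗⇒≈ᴿ : ∀ a b → (∀ n → seq a n ≡ seq b n) → a ≈ᴿ b
≗⇒≈ᴿ a _ a≗b = mk≈ᴿ (≗⇒∼ˢ (cauchy a) a≗b)

------------------------------------------------------------------------
-- Complex numbers

record ℂ : Set where
  no-eta-equality
  field
    re im : ℝ

open ℂ public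

infix  4 _≈ᶜ_
infixl 6 _+ᶜ_
infixl 7 _*ᶜ_
infix  8 -ᶜ_

record _≈ᶜ_ (z w : ℂ) : Set where
  constructor mk≈ᶜ
  field
    re-≈ : re z ≈ᴿ re w
    im-≈ : im z ≈ᴿ im w

open _≈ᶜ_ public

0ᶜ 1ᶜ : ℂ
0ᶜ .re = 0ᴿ
0ᶜ .im = 0ᴿ
1ᶜ .re = 1ᴿ
1ᶜ .im = 0ᴿ

_+ᶜ_ _*ᶜ_ : ℂ → ℂ → ℂ
(z +ᶜ w) .re = re z +ᴿ re w
(z +ᶜ w) .im = im z +ᴿ im w
(z *ᶜ w) .re = re z *ᴿ re w -ᴿ im z *ᴿ im w
(z *ᶜ w) .im = re z *ᴿ im w +ᴿ im z *ᴿ re w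

-ᶜ_ : ℂ → ℂ
(-ᶜ z) .re = -ᴿ re z
(-ᶜ z) .im = -ᴿ im z

conj : ℂ → ℂ
conj z .re = re z
conj z .im = -ᴿ im z

∣_∣² : ℂ → ℝ
∣ z ∣² = re z *ᴿ re z +ᴿ im z *ᴿ im z

private

  pointwise : ∀ z w → (∀ n → seq (re z) n ≡ seq (re w) n) →
              (∀ n → seq (im z) n ≡ seq (im w) n) → z ≈ᶜ w
  pointwise z w p q = mk≈ᶜ (≗⇒≈ᴿ (re z) (re w) p) (≗⇒≈ᴿ (im z) (im w) q)

  module ≈ᴿ = IsEquivalence ≈ᴿ-isEquivalence

  module Identity where

    assoc-re : ∀ a b c d e f →
      (a ℚ.* c ℚ.- b ℚ.* d) ℚ.* e ℚ.- (a ℚ.* d ℚ.+ b ℚ.* c) ℚ.* f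
        ≡ a ℚ.* (c ℚ.* e ℚ.- d ℚ.* f) ℚ.- b ℚ.* (c ℚ.* f ℚ.+ d ℚ.* e)
    assoc-re = solve 6 (λ a b c d e f →
      (a :* c :- b :* d) :* e :- (a :* d :+ b :* c) :* f
        := a :* (c :* e :- d :* f) :- b :* (c :* f :+ d :* e)) refl

    assoc-im : ∀ a b c d e f →
      (a ℚ.* c ℚ.- b ℚ.* d) ℚ.* f ℚ.+ (a ℚ.* d ℚ.+ b ℚ.* c) ℚ.* e
        ≡ a ℚ.* (c ℚ.* f ℚ.+ d ℚ.* e) ℚ.+ b ℚ.* (c ℚ.* e ℚ.- d ℚ.* f)
    assoc-im = solve 6 (λ a b c d e f →
      (a :* c :- b :* d) :* f :+ (a :* d :+ b :* c) :* e
        := a :* (c :* f :+ d :* e) :+ b :* (c :* e :- d :* f)) refl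

    identityˡ-re : ∀ a b →
      1ℚ ℚ.* a ℚ.- 0ℚ ℚ.* b ≡ a
    identityˡ-re = solve 2 (λ a b →
      con 1ℚ :* a :- con 0ℚ :* b := a) refl

    identityˡ-im : ∀ a b →
      1ℚ ℚ.* b ℚ.+ 0ℚ ℚ.* a ≡ b
    identityˡ-im = solve 2 (λ a b →
      con 1ℚ :* b :+ con 0ℚ :* a := b) refl

    distribˡ-re : ∀ a b c d e f →
      a ℚ.* (c ℚ.+ e) ℚ.- b ℚ.* (d ℚ.+ f)
        ≡ (a ℚ.* c ℚ.- b ℚ.* d) ℚ.+ (a ℚ.* e ℚ.- b ℚ.* f)
    distribˡ-re = solve 6 (λ a b c d e f →
      a :* (c :+ e) :- b :* (d :+ f) := (a :* c :- b :* d) :+ (a :* e :- b :* f)) refl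

    distribˡ-im : ∀ a b c d e f →
      a ℚ.* (d ℚ.+ f) ℚ.+ b ℚ.* (c ℚ.+ e)
        ≡ (a ℚ.* d ℚ.+ b ℚ.* c) ℚ.+ (a ℚ.* f ℚ.+ b ℚ.* e)
    distribˡ-im = solve 6 (λ a b c d e f →
      a :* (d :+ f) :+ b :* (c :+ e) := (a :* d :+ b :* c) :+ (a :* f :+ b :* e)) refl

    comm-re : ∀ a b c d →
      a ℚ.* c ℚ.- b ℚ.* d ≡ c ℚ.* a ℚ.- d ℚ.* b
    comm-re = solve 4 (λ a b c d →
      a :* c :- b :* d := c :* a :- d :* b) refl

    comm-im : ∀ a b c d →
      a ℚ.* d ℚ.+ b ℚ.* c ≡ c ℚ.* b ℚ.+ d ℚ.* a
    comm-im = solve 4 (λ a b c d →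
      a :* d :+ b :* c := c :* b :+ d :* a) refl

    ∣∣²-* : ∀ a b c d →
      (a ℚ.* c ℚ.- b ℚ.* d) ℚ.* (a ℚ.* c ℚ.- b ℚ.* d)
        ℚ.+ (a ℚ.* d ℚ.+ b ℚ.* c) ℚ.* (a ℚ.* d ℚ.+ b ℚ.* c)
        ≡ (a ℚ.* a ℚ.+ b ℚ.* b) ℚ.* (c ℚ.* c ℚ.+ d ℚ.* d)
    ∣∣²-* = solve 4 (λ a b c d →
      (a :* c :- b :* d) :* (a :* c :- b :* d) :+ (a :* d :+ b :* c) :* (a :* d :+ b :* c)
        := (a :* a :+ b :* b) :* (c :* c :+ d :* d)) refl

    ∣∣²-conj : ∀ a b →
      a ℚ.* a ℚ.+ (ℚ.- b) ℚ.* (ℚ.- b) ≡ a ℚ.* a ℚ.+ b ℚ.* b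
    ∣∣²-conj = solve 2 (λ a b →
      a :* a :+ (:- b) :* (:- b) := a :* a :+ b :* b) refl

  +ᶜ-assoc : ∀ z w v → (z +ᶜ w) +ᶜ v ≈ᶜ z +ᶜ (w +ᶜ v)
  +ᶜ-assoc z w v = pointwise _ _
    (λ n → ℚ.+-assoc (seq (re z) n) (seq (re w) n) (seq (re v) n))
    (λ n → ℚ.+-assoc (seq (im z) n) (seq (im w) n) (seq (im v) n))

  +ᶜ-comm : ∀ z w → z +ᶜ w ≈ᶜ w +ᶜ z
  +ᶜ-comm z w = pointwise _ _
    (λ n → ℚ.+-comm (seq (re z) n) (seq (re w) n))
    (λ n → ℚ.+-comm (seq (im z) n) (seq (im w) n))

  +ᶜ-identityˡ : ∀ z → 0ᶜ +ᶜ z ≈ᶜ z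
  +ᶜ-identityˡ z = pointwise _ _
    (λ n → ℚ.+-identityˡ (seq (re z) n)) (λ n → ℚ.+-identityˡ (seq (im z) n))

  -ᶜ-inverseˡ : ∀ z → -ᶜ z +ᶜ z ≈ᶜ 0ᶜ
  -ᶜ-inverseˡ z = pointwise _ _
    (λ n → ℚ.+-inverseˡ (seq (re z) n)) (λ n → ℚ.+-inverseˡ (seq (im z) n))

  *ᶜ-assoc : ∀ z w v → (z *ᶜ w) *ᶜ v ≈ᶜ z *ᶜ (w *ᶜ v)
  *ᶜ-assoc z w v = pointwise _ _
    (λ n → Identity.assoc-re (seq (re z) n) (seq (im z) n) (seq (re w) n) (seq (im w) n)
      (seq (re v) n) (seq (im v) n))
    (λ n → Identity.assoc-im (seq (re z) n) (seq (im z) n) (seq (re w) n) (seq (im w) n)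
      (seq (re v) n) (seq (im v) n))

  *ᶜ-comm : ∀ z w → z *ᶜ w ≈ᶜ w *ᶜ z
  *ᶜ-comm z w = pointwise _ _
    (λ n → Identity.comm-re (seq (re z) n) (seq (im z) n) (seq (re w) n) (seq (im w) n))
    (λ n → Identity.comm-im (seq (re z) n) (seq (im z) n) (seq (re w) n) (seq (im w) n))

  *ᶜ-identityˡ : ∀ z → 1ᶜ *ᶜ z ≈ᶜ z
  *ᶜ-identityˡ z = pointwise _ _
    (λ n → Identity.identityˡ-re (seq (re z) n) (seq (im z) n))
    (λ n → Identity.identityˡ-im (seq (re z) n) (seq (im z) n))

  *ᶜ-distribˡ : ∀ z w v → z *ᶜ (w +ᶜ v) ≈ᶜ z *ᶜ w +ᶜ z *ᶜ v
  *ᶜ-distribˡ z w v = pointwise _ _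
    (λ n → Identity.distribˡ-re (seq (re z) n) (seq (im z) n) (seq (re w) n) (seq (im w) n)
      (seq (re v) n) (seq (im v) n))
    (λ n → Identity.distribˡ-im (seq (re z) n) (seq (im z) n) (seq (re w) n) (seq (im w) n)
      (seq (re v) n) (seq (im v) n))

  ≈ᶜ-isEquivalence : IsEquivalence _≈ᶜ_
  ≈ᶜ-isEquivalence = record
    { refl  = mk≈ᶜ ≈ᴿ.refl ≈ᴿ.refl
    ; sym   = λ (mk≈ᶜ p q) → mk≈ᶜ (≈ᴿ.sym p) (≈ᴿ.sym q)
    ; trans = λ (mk≈ᶜ p q) (mk≈ᶜ p′ q′) → mk≈ᶜ (≈ᴿ.trans p p′) (≈ᴿ.trans q q′)
    }

  module ≈ᶜ = IsEquivalence ≈ᶜ-isEquivalence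

  +ᶜ-cong : ∀ {z z′ w w′} → z ≈ᶜ z′ → w ≈ᶜ w′ → z +ᶜ w ≈ᶜ z′ +ᶜ w′
  +ᶜ-cong (mk≈ᶜ p q) (mk≈ᶜ p′ q′) = mk≈ᶜ (+ᴿ-cong p p′) (+ᴿ-cong q q′)

  *ᶜ-cong : ∀ {z z′ w w′} → z ≈ᶜ z′ → w ≈ᶜ w′ → z *ᶜ w ≈ᶜ z′ *ᶜ w′
  *ᶜ-cong (mk≈ᶜ p q) (mk≈ᶜ p′ q′) = mk≈ᶜ
    (+ᴿ-cong (*ᴿ-cong p p′) (-ᴿ-cong (*ᴿ-cong q q′)))
    (+ᴿ-cong (*ᴿ-cong p q′) (*ᴿ-cong q p′))

  ∣∣²-* : ∀ z w → ∣ z *ᶜ w ∣² ≈ᴿ ∣ z ∣² *ᴿ ∣ w ∣²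
  ∣∣²-* z w = ≗⇒≈ᴿ _ _ λ n →
    Identity.∣∣²-* (seq (re z) n) (seq (im z) n) (seq (re w) n) (seq (im w) n)

  ∣∣²-conj : ∀ z → ∣ conj z ∣² ≈ᴿ ∣ z ∣²
  ∣∣²-conj z = ≗⇒≈ᴿ _ _ λ n → Identity.∣∣²-conj (seq (re z) n) (seq (im z) n)

ℂ-commutativeRing : CommutativeRing 0ℓ 0ℓ
ℂ-commutativeRing = record
  { Carrier = ℂ
  ; _≈_ = _≈ᶜ_
  ; _+_ = _+ᶜ_
  ; _*_ = _*ᶜ_
  ; -_  = -ᶜ_
  ; 0#  = 0ᶜ
  ; 1#  = 1ᶜ
  ; isCommutativeRing = record
    { isRing = record
      { +-isAbelianGroup = record
        { isGroup = record
          { isMonoid = record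
            { isSemigroup = record
              { isMagma = record { isEquivalence = ≈ᶜ-isEquivalence ; ∙-cong = +ᶜ-cong }
              ; assoc = +ᶜ-assoc
              }
            ; identity = +ᶜ-identityˡ , λ z → ≈ᶜ.trans (+ᶜ-comm z 0ᶜ) (+ᶜ-identityˡ z)
            }
          ; inverse = -ᶜ-inverseˡ , λ z → ≈ᶜ.trans (+ᶜ-comm z (-ᶜ z)) (-ᶜ-inverseˡ z)
          ; ⁻¹-cong = λ (mk≈ᶜ p q) → mk≈ᶜ (-ᴿ-cong p) (-ᴿ-cong q)
          }
        ; comm = +ᶜ-comm
        }
      ; *-cong = *ᶜ-cong
      ; *-assoc = *ᶜ-assoc
      ; *-identity = *ᶜ-identityˡ , λ z → ≈ᶜ.trans (*ᶜ-comm z 1ᶜ) (*ᶜ-identityˡ z)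
      ; distrib = *ᶜ-distribˡ , λ z w v →
          ≈ᶜ.trans (*ᶜ-comm (w +ᶜ v) z)
            (≈ᶜ.trans (*ᶜ-distribˡ z w v) (+ᶜ-cong (*ᶜ-comm z w) (*ᶜ-comm z v)))
      }
    ; *-comm = *ᶜ-comm
    }
  }

ℂ-rawRing : RawRing 0ℓ 0ℓ
ℂ-rawRing = CommutativeRing.rawRing ℂ-commutativeRing

------------------------------------------------------------------------
-- The unit circle

-- ∣z∣ = 1 is expressed as ∣z∣² = 1, which avoids taking square roots.

record 𝕋 : Set where
  no-eta-equality
  field
    val  : ℂ
    unit : ∣ val ∣² ≈ᴿ 1ᴿ

open 𝕋 public

infix  4 _≈ᵀ_
infixl 7 _*ᵀ_

_≈ᵀ_ : 𝕋 → 𝕋 → Set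
z ≈ᵀ w = val z ≈ᶜ val w

1ᵀ : 𝕋
1ᵀ .val  = 1ᶜ
1ᵀ .unit = ≗⇒≈ᴿ ∣ 1ᶜ ∣² 1ᴿ (λ _ → refl)

_*ᵀ_ : 𝕋 → 𝕋 → 𝕋
(z *ᵀ w) .val  = val z *ᶜ val w
(z *ᵀ w) .unit = ≈ᴿ.trans (∣∣²-* (val z) (val w))
  (≈ᴿ.trans (*ᴿ-cong (unit z) (unit w)) (≗⇒≈ᴿ (1ᴿ *ᴿ 1ᴿ) 1ᴿ (λ _ → refl)))

conjᵀ : 𝕋 → 𝕋
conjᵀ z .val  = conj (val z)
conjᵀ z .unit = ≈ᴿ.trans (∣∣²-conj (val z)) (unit z)

------------------------------------------------------------------------
-- Matrices, polynomials and characteristic polynomials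

Matrix : ∀ {a} → Set a → ℕ → Set a
Matrix A n = Fin n → Fin n → A

-- Laplace expansion along the first row.

module Determinant {c ℓ} (R : RawRing c ℓ) where
  open RawRing R
  open RawMonoidOps +-rawMonoid using (sum)
  open RawSemiringOps rawSemiring using (_^_)

  det : ∀ n → Matrix Carrier n → Carrier
  det zero    M = 1#
  det (suc n) M = sum λ j →
    (- 1#) ^ toℕ j * (M zero j * det n (λ i k → M (suc i) (punchIn j k)))

-- A polynomial is the list of its coefficients, constant term first;
-- trailing zeros are allowed, so equality is that of all coefficients.

module Polynomial {c ℓ} (R : RawRing c ℓ) where
  open RawRing R

  Poly : Set c
  Poly = List Carrier

  coeff : Poly → ℕ → Carrier
  coeff []      _       = 0#
  coeff (a ∷ p) zero    = a
  coeff (a ∷ p) (suc k) = coeff p k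

  infix  4 _≈ᴾ_
  infixl 6 _+ᴾ_
  infixl 7 _*ᴾ_

  _≈ᴾ_ : Poly → Poly → Set ℓ
  p ≈ᴾ q = ∀ k → coeff p k ≈ coeff q k

  _+ᴾ_ : Poly → Poly → Poly
  []      +ᴾ q       = q
  (a ∷ p) +ᴾ []      = a ∷ p
  (a ∷ p) +ᴾ (b ∷ q) = (a + b) ∷ (p +ᴾ q)

  _*ᴾ_ : Poly → Poly → Poly
  []      *ᴾ q = []
  (a ∷ p) *ᴾ q = map (a *_) q +ᴾ (0# ∷ (p *ᴾ q))

  constᴾ : Carrier → Poly
  constᴾ a = a ∷ []

  X : Poly
  X = 0# ∷ 1# ∷ []

  rawRing : RawRing c ℓ
  rawRing = record
    { Carrier = Poly
    ; _≈_ = _≈ᴾ_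
    ; _+_ = _+ᴾ_
    ; _*_ = _*ᴾ_
    ; -_  = map -_
    ; 0#  = []
    ; 1#  = constᴾ 1#
    }

  -- det (X I − M)
  charPoly : ∀ {n} → Matrix Carrier n → Poly
  charPoly {n} M = Determinant.det rawRing n λ i j →
    (if ⌊ i Fin.≟ j ⌋ then X else []) +ᴾ map -_ (constᴾ (M i j))

open Polynomial ℂ-rawRing public using (_≈ᴾ_; charPoly)

Cospectral : ∀ {n} → Matrix ℂ n → Matrix ℂ n → Set
Cospectral M N = charPoly M ≈ᴾ charPoly N

------------------------------------------------------------------------
-- Digraphs

record Digraph (n : ℕ) : Set where
  field
    adjacent : Fin n → Fin n → Bool

  Arc : Fin n → Fin n → Set
  Arc i j = T (adjacent i j)

  field
    loopless : ∀ i → ¬ Arc i i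

open Digraph public

adjacencyMatrix : ∀ {n} → Digraph n → Matrix ℂ n
adjacencyMatrix D i j = if adjacent D i j then 1ᶜ else 0ᶜ

module _ {n} (D : Digraph n) where

  Walk : Fin n → Fin n → Set
  Walk = Star (Arc D)

  vertices : ∀ {i j} → Walk i j → List (Fin n)
  vertices {i} nil     = i ∷ []
  vertices {i} (_ ◅ w) = i ∷ vertices w

  -- All vertices of a walk except its last one.
  sources : ∀ {i j} → Walk i j → List (Fin n)
  sources     nil     = []
  sources {i} (_ ◅ w) = i ∷ sources w

  Path : Fin n → Fin n → Set
  Path i j = Σ (Walk i j) λ w → Unique (vertices w)

  StronglyConnected : Set
  StronglyConnected = ∀ i j → Path i j

  -- The length is at least 1 by construction, hence at least 2 since D is
  -- loopless.
  record Cycle : Set where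
    field
      {start next} : Fin n
      first        : Arc D start next
      rest         : Walk next start
      distinct     : Unique (sources (first ◅ rest))

    closedWalk : Walk start start
    closedWalk = first ◅ rest

------------------------------------------------------------------------
-- 𝕋-gain digraphs

-- Φ = (D , gain), with the underlying digraph as a parameter.

record GainDigraph {n} (D : Digraph n) : Set where
  field
    gain : ∀ i j → Arc D i j → 𝕋

open GainDigraph public

module _ {n} {D : Digraph n} where

  gainMatrix : GainDigraph D → Matrix ℂ n
  gainMatrix Φ i j with T? (adjacent D i j)
  ... | yes arc = val (gain Φ i j arc)
  ... | no  _   = 0ᶜ

  walkGain : GainDigraph D → ∀ {i j} → Walk D i j → 𝕋
  walkGain Φ nil                 = 1ᵀ
  walkGain Φ (_◅_ {i} {j} arc w) = gain Φ i j arc *ᵀ walkGain Φ w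

  CycleBalanced : GainDigraph D → Set
  CycleBalanced Φ = ∀ (C : Cycle D) → walkGain Φ (Cycle.closedWalk C) ≈ᵀ 1ᵀ

  switch : GainDigraph D → (Fin n → 𝕋) → GainDigraph D
  switch Φ σ .gain i j arc = σ i *ᵀ gain Φ i j arc *ᵀ conjᵀ (σ j)

  infix 4 _≈ᴳ_ _∼_

  _≈ᴳ_ : GainDigraph D → GainDigraph D → Set
  Φ ≈ᴳ Ψ = ∀ i j arc → gain Φ i j arc ≈ᵀ gain Ψ i j arc

  _∼_ : GainDigraph D → GainDigraph D → Set
  Φ ∼ Ψ = ∃ λ σ → Ψ ≈ᴳ switch Φ σ

  IsPotential : GainDigraph D → (Fin n → 𝕋) → Set
  IsPotential Φ ψ = ∀ i j arc → gain Φ i j arc ≈ᵀ conjᵀ (ψ i) *ᵀ ψ j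

  HasPotential : GainDigraph D → Set
  HasPotential Φ = ∃ (IsPotential Φ)

trivialGain : ∀ {n} (D : Digraph n) → GainDigraph D
trivialGain D .gain _ _ _ = 1ᵀ

{-# OPTIONS --safe #-}
module Submission where

-- The hard direction, from cospectrality to balance, goes through the
-- power series 1 / det (I − t M). Let M′ be M without its first row and
-- column. By Cramer's rule det (I − t M′) / det (I − t M) is the series
-- W(M) = Σₖ (Mᵏ)₀₀ tᵏ of closed walks at vertex 0, so that
-- 1 / det (I − t M) = W(M) W(M′) W(M″) ⋯. For M = A(Φ) each coefficient
-- of this product is a sum of units, one for every tuple of closed walks,
-- and for M = A(D) it is the number of these units. If the two agree, then
-- all the units are 1, in particular the gains of all closed walks at
-- vertex 0, and the gains of walks from vertex 0 form a potential.

open import Defs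
open import Data.Nat.Base using (ℕ)
open import Data.Product.Base using (_×_)
open import Function.Bundles using (_⇔_)

open import Algebra.Bundles using (CommutativeRing)
open import Algebra.Bundles.Raw using (RawRing)
import Algebra.Definitions.RawMonoid as RawMonoidOps
import Algebra.Definitions.RawSemiring as RawSemiringOps
import Algebra.Properties.Ring as RingProperties
import Algebra.Properties.Semiring.Sum as Sum
import Algebra.Solver.Ring.NaturalCoefficients.Default as SemiringSolver
open import Data.Bool.Base using (if_then_else_; true; false)
open import Data.Bool.Properties using (T?; T-irrelevant)
open import Data.Fin.Base using (Fin; zero; suc; toℕ; punchIn)
import Data.Fin.Properties as Fin
open import Data.List.Base using ([]; _∷_; map)
open import Data.List.Membership.Propositional using (_∈_)
import Data.List.Membership.DecPropositional as DecMembership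
open import Data.List.Relation.Unary.All as All using (All; []; _∷_)
open import Data.List.Relation.Unary.All.Properties using (¬Any⇒All¬)
open import Data.List.Relation.Unary.AllPairs using ([]; _∷_)
open import Data.List.Relation.Unary.Any using (here; there)
open import Data.List.Relation.Unary.Unique.Propositional using (Unique)
open import Data.Nat.Base as ℕ using (zero; suc; z≤n; s≤s)
import Data.Nat.Properties as ℕ
open import Data.Product.Base using (_,_; proj₁; proj₂; ∃)
open import Data.Rational.Base as ℚ using (0ℚ; 1ℚ; ½; ∣_∣)
import Data.Rational.Properties as ℚ
open import Data.Rational.Solver using (module +-*-Solver)
open import Data.Sum.Base using (inj₁; inj₂)
open import Data.Unit.Base using (tt)
open import Function.Base using (_∘_)
open import Function.Bundles using (mk⇔)
open import Relation.Binary.Construct.Closure.ReflexiveTransitive using (_◅_; _◅◅_)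
  renaming (ε to nil)
open import Relation.Binary.PropositionalEquality as ≡ using (_≡_; _≢_)
import Relation.Binary.Reasoning.Setoid as SetoidReasoning
open import Relation.Binary.Structures using (IsEquivalence)
open import Relation.Nullary using (¬_; yes; no; contradiction)
open import Relation.Nullary.Decidable using (⌊_⌋)

-- Determinants

-- The Laplace expansion along the first two rows chooses column j and
-- then column k of the remaining ones; choosing the same two columns in
-- the other order gives the indices j′ and k′.

-- The obstacle is cancellation. A coefficient of the characteristic polynomial is a signed sum over
-- families of disjoint cycles, and equality of two such sums says nothing about a single cycle.
-- Taking the reciprocal removes all signs: its coefficients count families of closed walks with
-- weights, so every term can be compared with 1. The comparison is the equality case of the
-- triangle inequality, taken on real parts. Equality of Cauchy reals cannot be decided, so no term
-- is ever tested for being 1; a chosen unit is set apart from the sum and squeezed between two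
-- inequalities. The characteristic polynomial lives on coefficient lists, whereas Cramer's rule is
-- applied in a commutative ring of power series. Reversing coefficients bridges the two and also
-- turns X I - M into I - t M. The same series gives the converse direction, because switching
-- leaves the weights of closed walks unchanged.

data Swapped : ∀ {m} → Fin (suc m) → Fin m → Fin (suc m) → Fin m → Set where
  zero : ∀ {m} {k : Fin (suc m)} → Swapped zero k (suc k) zero
  suc  : ∀ {m} {j j′ : Fin (suc m)} {k k′ : Fin m} →
         Swapped j k j′ k′ → Swapped (suc j) (suc k) (suc j′) (suc k′)

swapped-punchIn : ∀ {m} {j j′ : Fin (suc m)} {k k′} → Swapped j k j′ k′ →
  punchIn j k ≡ j′ × punchIn j′ k′ ≡ j
swapped-punchIn zero    = ≡.refl , ≡.refl
swapped-punchIn (suc s) = let p , q = swapped-punchIn s in ≡.cong suc p , ≡.cong suc q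

swapped-punchIn₂ : ∀ {m} {j j′ : Fin (suc (suc m))} {k k′} → Swapped j k j′ k′ → ∀ c →
  punchIn j (punchIn k c) ≡ punchIn j′ (punchIn k′ c)
swapped-punchIn₂ zero    c       = ≡.refl
swapped-punchIn₂ (suc s) zero    = ≡.refl
swapped-punchIn₂ (suc s) (suc c) = ≡.cong suc (swapped-punchIn₂ s c)

module LaplaceExpansion {c ℓ} (R : CommutativeRing c ℓ) where

  open CommutativeRing R hiding (zero)
  open Determinant rawRing
  open RawSemiringOps (RawRing.rawSemiring rawRing) using (_^_)
  open Sum semiring
  open SemiringSolver commutativeSemiring using (solve; _:+_; _:*_; _:=_; con)
  open SetoidReasoning setoid

  sign : ∀ {n} → Fin n → Carrier
  sign j = (- 1#) ^ toℕ j

  minor : ∀ {m n} → (Fin m → Fin (suc n) → Carrier) → Fin (suc n) → Fin m → Fin n → Carrier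
  minor N j i k = N i (punchIn j k)

  -- The determinant with first row `a` above the rows `N`. Keeping them apart lets the first row
  -- vary while the minors stay definitionally the same.
  expand : ∀ {n} → (Fin (suc n) → Carrier) → (Fin n → Fin (suc n) → Carrier) → Carrier
  expand {n} a N = sum λ j → sign j * (a j * det n (minor N j))

  sum-zero : ∀ {n} (f : Fin n → Carrier) → (∀ i → f i ≈ 0#) → sum f ≈ 0#
  sum-zero {n} f f≈0 = trans (sum-cong-≋ f≈0) (sum-replicate-zero n)

  det-cong : ∀ n {M N : Matrix Carrier n} → (∀ i j → M i j ≈ N i j) → det n M ≈ det n N
  det-cong zero    M≈N = refl
  det-cong (suc n) M≈N = sum-cong-≋ λ j →
    *-congˡ {x = sign j} (*-cong (M≈N zero j) (det-cong n λ i k → M≈N (suc i) (punchIn j k)))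

  expand-combination : ∀ {m n} (g : Fin m → Carrier) (A : Fin m → Fin (suc n) → Carrier)
    (N : Fin n → Fin (suc n) → Carrier) →
    expand (λ j → sum λ i → g i * A i j) N ≈ sum λ i → g i * expand (A i) N
  expand-combination {m} {n} g A N = begin
    (sum λ j → sign j * ((sum λ i → g i * A i j) * d j))
      ≈⟨ sum-cong-≋ (λ j → trans (*-congˡ (*-distribʳ-sum (d j) (λ i → g i * A i j)))
                                 (*-distribˡ-sum (sign j) (λ i → g i * A i j * d j))) ⟩
    (sum λ j → sum λ i → sign j * (g i * A i j * d j))
      ≈⟨ sum-cong-≋ (λ j → sum-cong-≋ λ i → rearrange (sign j) (g i) (A i j) (d j)) ⟩
    (sum λ j → sum λ i → g i * (sign j * (A i j * d j)))
      ≈⟨ ∑-comm (λ j i → g i * (sign j * (A i j * d j))) ⟩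
    (sum λ i → sum λ j → g i * (sign j * (A i j * d j)))
      ≈⟨ sum-cong-≋ (λ i → sym (*-distribˡ-sum (g i) (λ j → sign j * (A i j * d j)))) ⟩
    (sum λ i → g i * expand (A i) N) ∎
    where
    d : Fin (suc n) → Carrier
    d j = det n (minor N j)
    rearrange : ∀ s x y z → s * (x * y * z) ≈ x * (s * (y * z))
    rearrange = solve 4 (λ s x y z → s :* (x :* y :* z) := x :* (s :* (y :* z))) refl

  -- Three matrices that agree off row `i`, rather than an updated row, let the hypotheses pass to
  -- the minors by reindexing columns.
  det-row-+ : ∀ n i (M A B : Matrix Carrier n) → (∀ j → M i j ≈ A i j + B i j) →
    (∀ k → k ≢ i → ∀ j → M k j ≈ A k j × M k j ≈ B k j) → det n M ≈ det n A + det n B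
  det-row-+ (suc n) i M A B row rest =
    trans (sum-cong-≋ (term i row rest)) (∑-distrib-+
      (λ j → sign j * (A zero j * dA j)) (λ j → sign j * (B zero j * dB j)))
    where
    dM dA dB : Fin (suc n) → Carrier
    dM j = det n (minor (M ∘ suc) j)
    dA j = det n (minor (A ∘ suc) j)
    dB j = det n (minor (B ∘ suc) j)
    distrib₁ : ∀ s a b d → s * ((a + b) * d) ≈ s * (a * d) + s * (b * d)
    distrib₁ = solve 4 (λ s a b d → s :* ((a :+ b) :* d) := s :* (a :* d) :+ s :* (b :* d)) refl
    distrib₂ : ∀ s a d e → s * (a * (d + e)) ≈ s * (a * d) + s * (a * e)
    distrib₂ = solve 4 (λ s a d e → s :* (a :* (d :+ e)) := s :* (a :* d) :+ s :* (a :* e)) refl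
    term : ∀ i → (∀ j → M i j ≈ A i j + B i j) →
      (∀ k → k ≢ i → ∀ j → M k j ≈ A k j × M k j ≈ B k j) → ∀ j →
      sign j * (M zero j * dM j) ≈ sign j * (A zero j * dA j) + sign j * (B zero j * dB j)
    term zero row rest j = begin
      sign j * (M zero j * dM j)                ≈⟨ *-congˡ (*-congʳ (row j)) ⟩
      sign j * ((A zero j + B zero j) * dM j)   ≈⟨ distrib₁ _ _ _ _ ⟩
      sign j * (A zero j * dM j) + sign j * (B zero j * dM j)
        ≈⟨ +-cong (*-congˡ (*-congˡ (det-cong n λ k c → proj₁ (rest (suc k) (λ ()) (punchIn j c)))))
                  (*-congˡ (*-congˡ (det-cong n λ k c → proj₂ (rest (suc k) (λ ()) (punchIn j c))))) ⟩
      sign j * (A zero j * dA j) + sign j * (B zero j * dB j) ∎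
    term (suc i) row rest j = begin
      sign j * (M zero j * dM j)
        ≈⟨ *-congˡ (*-congˡ (det-row-+ n i _ _ _ (λ c → row (punchIn j c))
             (λ k k≢i c → rest (suc k) (k≢i ∘ Fin.suc-injective) (punchIn j c)))) ⟩
      sign j * (M zero j * (dA j + dB j))
        ≈⟨ distrib₂ _ _ _ _ ⟩
      sign j * (M zero j * dA j) + sign j * (M zero j * dB j)
        ≈⟨ +-cong (*-congˡ (*-congʳ (proj₁ (rest zero (λ ()) j))))
                  (*-congˡ (*-congʳ (proj₂ (rest zero (λ ()) j)))) ⟩
      sign j * (A zero j * dA j) + sign j * (B zero j * dB j) ∎

  -- `Swapped` lists each unordered pair of columns once. The terms with `j` or `k` zero pair up
  -- among themselves, and what remains is the same sum one size smaller.
  sum-swapped : ∀ m (G : Fin (suc m) → Fin m → Carrier) →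
    (∀ {j k j′ k′} → Swapped j k j′ k′ → G j k + G j′ k′ ≈ 0#) →
    (sum λ j → sum λ k → G j k) ≈ 0#
  sum-swapped zero    G cancel = +-identityˡ 0#
  sum-swapped (suc m) G cancel = begin
    sum (G zero) + (sum λ j → G (suc j) zero + sum (G (suc j) ∘ suc))
      ≈⟨ +-congˡ (∑-distrib-+ (λ j → G (suc j) zero) (λ j → sum (G (suc j) ∘ suc))) ⟩
    sum (G zero) + ((sum λ j → G (suc j) zero) + (sum λ j → sum (G (suc j) ∘ suc)))
      ≈⟨ +-congˡ (trans (+-congˡ (sum-swapped m _ (cancel ∘ suc))) (+-identityʳ _)) ⟩
    sum (G zero) + (sum λ j → G (suc j) zero)
      ≈⟨ sym (∑-distrib-+ (G zero) (λ j → G (suc j) zero)) ⟩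
    (sum λ j → G zero j + G (suc j) zero)
      ≈⟨ sum-zero (λ j → G zero j + G (suc j) zero) (λ j → cancel zero) ⟩
    0# ∎

  -- Removing the left column first shifts the index of the right one down by one, which costs a
  -- single factor -1; removing the right column first shifts nothing.
  sign-swapped : ∀ {m} {j j′ : Fin (suc m)} {k k′} → Swapped j k j′ k′ →
    sign j * sign k + sign j′ * sign k′ ≈ 0#
  sign-swapped {k = k} zero = begin
    1# * sign k + (- 1# * sign k) * 1#  ≈⟨ factor (- 1#) (sign k) ⟩
    (1# + - 1#) * sign k                ≈⟨ *-congʳ (-‿inverseʳ 1#) ⟩
    0# * sign k                         ≈⟨ zeroˡ _ ⟩
    0#                                  ∎
    where
    factor : ∀ e s → 1# * s + (e * s) * 1# ≈ (1# + e) * s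
    factor = solve 2 (λ e s → con 1 :* s :+ (e :* s) :* con 1 := (con 1 :+ e) :* s) refl
  sign-swapped {j = suc j} {suc j′} {suc k} {suc k′} (suc s) = begin
    (- 1# * sign j) * (- 1# * sign k) + (- 1# * sign j′) * (- 1# * sign k′)
      ≈⟨ factor (- 1#) (sign j) (sign k) (sign j′) (sign k′) ⟩
    (- 1# * - 1#) * (sign j * sign k + sign j′ * sign k′)
      ≈⟨ *-congˡ (sign-swapped s) ⟩
    (- 1# * - 1#) * 0#
      ≈⟨ zeroʳ _ ⟩
    0# ∎
    where
    factor : ∀ e a b a′ b′ →
      (e * a) * (e * b) + (e * a′) * (e * b′) ≈ (e * e) * (a * b + a′ * b′)
    factor = solve 5 (λ e a b a′ b′ →
      (e :* a) :* (e :* b) :+ (e :* a′) :* (e :* b′) := (e :* e) :* (a :* b :+ a′ :* b′)) refl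

  -- Both orders of choosing two columns leave the same minor, and equal rows make the products of
  -- the two chosen entries agree, so only the opposite signs differ.
  det-equal-rows₀₁ : ∀ n (M : Matrix Carrier (suc (suc n))) →
    (∀ j → M zero j ≈ M (suc zero) j) → det (suc (suc n)) M ≈ 0#
  det-equal-rows₀₁ n M M₀≈M₁ = trans
    (sum-cong-≋ λ j → trans (*-congˡ (*-distribˡ-sum (a j) (inner j)))
      (*-distribˡ-sum (sign j) (λ k → a j * inner j k)))
    (sum-swapped (suc n) (λ j k → sign j * (a j * inner j k)) cancel)
    where
    a : Fin (suc (suc n)) → Carrier
    a = M zero
    d : Fin (suc (suc n)) → Fin (suc n) → Carrier
    d j k = det n λ i c → M (suc (suc i)) (punchIn j (punchIn k c))
    inner : Fin (suc (suc n)) → Fin (suc n) → Carrier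
    inner j k = sign k * (M (suc zero) (punchIn j k) * d j k)
    factor : ∀ s t s′ t′ x y d → s * (x * (t * (y * d))) + s′ * (y * (t′ * (x * d)))
      ≈ (s * t + s′ * t′) * (x * y * d)
    factor = solve 7 (λ s t s′ t′ x y d → s :* (x :* (t :* (y :* d))) :+ s′ :* (y :* (t′ :* (x :* d)))
      := (s :* t :+ s′ :* t′) :* (x :* y :* d)) refl
    M₁-at : ∀ {j k l} → punchIn j k ≡ l → M (suc zero) (punchIn j k) ≈ a l
    M₁-at ≡.refl = sym (M₀≈M₁ _)
    cancel : ∀ {j k j′ k′} → Swapped j k j′ k′ →
      sign j * (a j * inner j k) + sign j′ * (a j′ * inner j′ k′) ≈ 0#
    cancel {j} {k} {j′} {k′} s = begin
      sign j * (a j * inner j k) + sign j′ * (a j′ * inner j′ k′)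
        ≈⟨ +-cong (*-congˡ (*-congˡ (*-congˡ (*-congʳ (M₁-at (proj₁ (swapped-punchIn s)))))))
                  (*-congˡ (*-congˡ (*-congˡ (*-cong (M₁-at (proj₂ (swapped-punchIn s)))
                    (det-cong n λ i c → reflexive
                      (≡.cong (M (suc (suc i))) (≡.sym (swapped-punchIn₂ s c)))))))) ⟩
      sign j * (a j * (sign k * (a j′ * d j k))) + sign j′ * (a j′ * (sign k′ * (a j * d j k)))
        ≈⟨ factor (sign j) (sign k) (sign j′) (sign k′) (a j) (a j′) (d j k) ⟩
      (sign j * sign k + sign j′ * sign k′) * (a j * a j′ * d j k)
        ≈⟨ trans (*-congʳ (sign-swapped s)) (zeroˡ _) ⟩
      0# ∎

  -- Repetitions of row 0 are the ones that `cramer` produces, so one of the two equal rows is fixed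
  -- there.
  Alternating : ℕ → Set _
  Alternating n = ∀ (i : Fin n) (M : Matrix Carrier (suc n)) →
    (∀ j → M zero j ≈ M (suc i) j) → det (suc n) M ≈ 0#

  exchange : ∀ {n} → Fin n → Fin (suc n) → Fin (suc n)
  exchange i zero    = suc i
  exchange i (suc k) = if ⌊ k Fin.≟ i ⌋ then zero else suc k

  -- Polarisation: with the sum of the two rows in both places the determinant vanishes, and
  -- expanding it additively leaves the two mixed terms, since the two pure ones vanish as well.
  det-exchange : ∀ n → Alternating n → ∀ i (M : Matrix Carrier (suc n)) →
    det (suc n) M + det (suc n) (M ∘ exchange i) ≈ 0#
  det-exchange n alternating i M = begin
    det (suc n) M + det (suc n) (M ∘ exchange i)
      ≈⟨ +-cong (det-cong (suc n) original) (det-cong (suc n) exchanged) ⟩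
    D x y + D y x
      ≈⟨ +-cong (sym (+-identityˡ _)) (sym (+-identityʳ _)) ⟩
    (0# + D x y) + (D y x + 0#)
      ≈⟨ +-cong (+-congʳ (sym (alternate x))) (+-congˡ (sym (alternate y))) ⟩
    (D x x + D x y) + (D y x + D y y)
      ≈⟨ +-cong (sym (additiveʳ x)) (sym (additiveʳ y)) ⟩
    D x x+y + D y x+y
      ≈⟨ sym additiveˡ ⟩
    D x+y x+y
      ≈⟨ alternate x+y ⟩
    0# ∎
    where
    rows : (u v : Fin (suc n) → Carrier) → Matrix Carrier (suc n)
    rows u v zero    = u
    rows u v (suc k) = if ⌊ k Fin.≟ i ⌋ then v else M (suc k)
    D : (u v : Fin (suc n) → Carrier) → Carrier
    D u v = det (suc n) (rows u v)
    x y x+y : Fin (suc n) → Carrier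
    x = M zero
    y = M (suc i)
    x+y j = x j + y j
    original : ∀ k j → M k j ≈ rows x y k j
    original zero    j = refl
    original (suc k) j with k Fin.≟ i
    ... | yes ≡.refl = refl
    ... | no  _      = refl
    exchanged : ∀ k j → M (exchange i k) j ≈ rows y x k j
    exchanged zero    j = refl
    exchanged (suc k) j with k Fin.≟ i
    ... | yes _ = refl
    ... | no  _ = refl
    rows-i : ∀ u v j → rows u v (suc i) j ≈ v j
    rows-i u v j with i Fin.≟ i
    ... | yes _   = refl
    ... | no  i≢i = contradiction ≡.refl i≢i
    alternate : ∀ u → D u u ≈ 0#
    alternate u = alternating i (rows u u) λ j → sym (rows-i u u j)
    others : ∀ u v v′ k → k ≢ suc i → ∀ j → rows u v k j ≈ rows u v′ k j
    others u v v′ zero    _   j = refl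
    others u v v′ (suc k) k≢i j with k Fin.≟ i
    ... | yes ≡.refl = contradiction ≡.refl k≢i
    ... | no  _      = refl
    additiveʳ : ∀ u → D u x+y ≈ D u x + D u y
    additiveʳ u = det-row-+ (suc n) (suc i) _ _ _
      (λ j → trans (rows-i u x+y j) (+-cong (sym (rows-i u x j)) (sym (rows-i u y j))))
      (λ k k≢i j → others u x+y x k k≢i j , others u x+y y k k≢i j)
    additiveˡ : D x+y x+y ≈ D x x+y + D y x+y
    additiveˡ = det-row-+ (suc n) zero (rows x+y x+y) (rows x x+y) (rows y x+y) (λ j → refl)
      λ { zero 0≢0 j → contradiction ≡.refl 0≢0 ; (suc k) _ j → refl , refl }

  -- Rows 1 and i are exchanged in every minor of the first row, which
  -- moves the repeated row next to row 0.

  det-equal-rows : ∀ n → Alternating n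
  det-equal-rows (suc n) zero    M M₀≈M₁ = det-equal-rows₀₁ n M M₀≈M₁
  det-equal-rows (suc n) (suc i) M M₀≈Mᵢ = begin
    expand (M zero) N
      ≈⟨ sym (+-identityʳ _) ⟩
    expand (M zero) N + 0#
      -- The zero added here is det `M′`, whose rows 0 and 1 are the two equal rows of `M`. Its
      -- minors along row 0 cancel those of `M` by exchange in one dimension less.
      ≈⟨ +-congˡ (sym (det-equal-rows₀₁ n M′ M₀≈Mᵢ)) ⟩
    expand (M zero) N + expand (M zero) (N ∘ exchange i)
      ≈⟨ sym (∑-distrib-+ (term N) (term (N ∘ exchange i))) ⟩
    (sum λ j → term N j + term (N ∘ exchange i) j)
      ≈⟨ sum-zero (λ j → term N j + term (N ∘ exchange i) j) (λ j → trans (factor (sign j) (M zero j) _ _)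
           (trans (*-congˡ (det-exchange n (det-equal-rows n) i (minor N j))) (zeroʳ _))) ⟩
    0# ∎
    where
    N : Fin (suc n) → Fin (suc (suc n)) → Carrier
    N = M ∘ suc
    term : (Fin (suc n) → Fin (suc (suc n)) → Carrier) → Fin (suc (suc n)) → Carrier
    term N j = sign j * (M zero j * det (suc n) (minor N j))
    M′ : Matrix Carrier (suc (suc n))
    M′ zero    = M zero
    M′ (suc k) = N (exchange i k)
    factor : ∀ s a d e → s * (a * d) + s * (a * e) ≈ (s * a) * (d + e)
    factor = solve 4 (λ s a d e → s :* (a :* d) :+ s :* (a :* e) := (s :* a) :* (d :+ e)) refl

  -- Replacing row 0 of M by e₀ = Σᵢ gᵢ Mᵢ turns det M into the first minor,
  -- while only the term with i = 0 contributes to the expansion.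

  cramer : ∀ n (g : Fin (suc n) → Carrier) (M : Matrix Carrier (suc n)) →
    (sum λ i → g i * M i zero) ≈ 1# → (∀ j → (sum λ i → g i * M i (suc j)) ≈ 0#) →
    g zero * det (suc n) M ≈ det n λ i j → M (suc i) (suc j)
  cramer n g M combination₀ combinationₛ = begin
    g zero * det (suc n) M
      ≈⟨ sym (+-identityʳ _) ⟩
    g zero * expand (M zero) N + 0#
      ≈⟨ +-congˡ (sym (sum-zero _ λ i → trans (*-congˡ
           (det-equal-rows n i (λ { zero → N i ; (suc k) → N k }) λ j → refl)) (zeroʳ _))) ⟩
    (sum λ i → g i * expand (M i) N)
      ≈⟨ sym (expand-combination g M N) ⟩
    expand (λ j → sum λ i → g i * M i j) N
      ≈⟨ +-cong (trans (*-identityˡ _) (trans (*-congʳ combination₀) (*-identityˡ _)))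
           (sum-zero _ λ j → trans (*-congˡ (trans (*-congʳ (combinationₛ j)) (zeroˡ _))) (zeroʳ _)) ⟩
    det n (minor N zero) + 0#
      ≈⟨ +-identityʳ _ ⟩
    det n (λ i j → M (suc i) (suc j)) ∎
    where
    N : Fin n → Fin (suc n) → Carrier
    N = M ∘ suc

-- Power series

module PowerSeries {c ℓ} (R : CommutativeRing c ℓ) where

  open CommutativeRing R hiding (zero)
  open SemiringSolver commutativeSemiring using (solve; _:+_; _:*_; _:=_)
  open SetoidReasoning setoid

  Series : Set c
  Series = ℕ → Carrier

  infix  4 _≋_
  infixl 6 _⊕_
  infixl 7 _⊛_

  record _≋_ (f g : Series) : Set ℓ where
    constructor pointwise
    field
      at : ∀ k → f k ≈ g k

  open _≋_ public

  _⊕_ _⊛_ : Series → Series → Series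
  (f ⊕ g) k = f k + g k
  (f ⊛ g) zero    = f 0 * g 0
  (f ⊛ g) (suc k) = f 0 * g (suc k) + (f ∘ suc ⊛ g) k

  const : Carrier → Series
  const a zero    = a
  const a (suc _) = 0#

  ⊛-cong : ∀ {f f′ g g′} → (∀ k → f k ≈ f′ k) → (∀ k → g k ≈ g′ k) → ∀ k → (f ⊛ g) k ≈ (f′ ⊛ g′) k
  ⊛-cong f≈ g≈ zero    = *-cong (f≈ 0) (g≈ 0)
  ⊛-cong f≈ g≈ (suc k) = +-cong (*-cong (f≈ 0) (g≈ (suc k))) (⊛-cong (f≈ ∘ suc) g≈ k)

  ⊛-zeroˡ : ∀ {f} g → (∀ k → f k ≈ 0#) → ∀ k → (f ⊛ g) k ≈ 0#
  ⊛-zeroˡ g f≈0 zero    = trans (*-congʳ (f≈0 0)) (zeroˡ _)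
  ⊛-zeroˡ g f≈0 (suc k) =
    trans (+-cong (trans (*-congʳ (f≈0 0)) (zeroˡ _)) (⊛-zeroˡ g (f≈0 ∘ suc) k)) (+-identityˡ 0#)

  ⊛-constˡ : ∀ f g → (∀ k → f (suc k) ≈ 0#) → ∀ k → (f ⊛ g) k ≈ f 0 * g k
  ⊛-constˡ f g f≈0 zero    = refl
  ⊛-constˡ f g f≈0 (suc k) = trans (+-congˡ (⊛-zeroˡ g f≈0 k)) (+-identityʳ _)

  ⊛-linearˡ : ∀ f g → (∀ k → f (suc (suc k)) ≈ 0#) → ∀ k →
    (f ⊛ g) (suc k) ≈ f 0 * g (suc k) + f 1 * g k
  ⊛-linearˡ f g f≈0 k = +-congˡ (⊛-constˡ (f ∘ suc) g f≈0 k)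

  ⊛-distribʳ : ∀ h f g k → ((f ⊕ g) ⊛ h) k ≈ (f ⊛ h) k + (g ⊛ h) k
  ⊛-distribʳ h f g zero    = distribʳ _ _ _
  ⊛-distribʳ h f g (suc k) =
    trans (+-congˡ (⊛-distribʳ h (f ∘ suc) (g ∘ suc) k)) (rearrange _ _ _ _ _)
    where
    rearrange : ∀ a b x y z → (a + b) * x + (y + z) ≈ (a * x + y) + (b * x + z)
    rearrange = solve 5 (λ a b x y z → (a :+ b) :* x :+ (y :+ z) := (a :* x :+ y) :+ (b :* x :+ z)) refl

  ⊛-scaleˡ : ∀ a f g k → ((λ i → a * f i) ⊛ g) k ≈ a * (f ⊛ g) k
  ⊛-scaleˡ a f g zero    = *-assoc _ _ _
  ⊛-scaleˡ a f g (suc k) =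
    trans (+-cong (*-assoc _ _ _) (⊛-scaleˡ a (f ∘ suc) g k)) (sym (distribˡ _ _ _))

  ⊛-assoc : ∀ f g h k → ((f ⊛ g) ⊛ h) k ≈ (f ⊛ (g ⊛ h)) k
  ⊛-assoc f g h zero    = *-assoc _ _ _
  ⊛-assoc f g h (suc k) = begin
    f 0 * g 0 * h (suc k) + (((f ⊛ g) ∘ suc) ⊛ h) k
      ≈⟨ +-congˡ (trans (⊛-distribʳ h (λ i → f 0 * g (suc i)) (f ∘ suc ⊛ g) k)
           (+-cong (⊛-scaleˡ (f 0) (g ∘ suc) h k) (⊛-assoc (f ∘ suc) g h k))) ⟩
    f 0 * g 0 * h (suc k) + (f 0 * (g ∘ suc ⊛ h) k + (f ∘ suc ⊛ (g ⊛ h)) k)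
      ≈⟨ rearrange _ _ _ _ _ ⟩
    f 0 * (g 0 * h (suc k) + (g ∘ suc ⊛ h) k) + (f ∘ suc ⊛ (g ⊛ h)) k ∎
    where
    rearrange : ∀ a b x y z → a * b * x + (a * y + z) ≈ a * (b * x + y) + z
    rearrange = solve 5 (λ a b x y z → a :* b :* x :+ (a :* y :+ z) := a :* (b :* x :+ y) :+ z) refl

  -- The mirror image of the defining clause, splitting off the constant term of the right factor;
  -- with it commutativity is a plain induction.
  ⊛-suc : ∀ f g k → (f ⊛ g) (suc k) ≈ f (suc k) * g 0 + (f ⊛ g ∘ suc) k
  ⊛-suc f g zero    = +-comm _ _
  ⊛-suc f g (suc k) = trans (+-congˡ (⊛-suc (f ∘ suc) g k)) (x∙yz≈y∙xz _ _ _)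
    where
    x∙yz≈y∙xz : ∀ x y z → x + (y + z) ≈ y + (x + z)
    x∙yz≈y∙xz = solve 3 (λ x y z → x :+ (y :+ z) := y :+ (x :+ z)) refl

  ⊛-comm : ∀ f g k → (f ⊛ g) k ≈ (g ⊛ f) k
  ⊛-comm f g zero    = *-comm _ _
  ⊛-comm f g (suc k) = trans (+-cong (*-comm _ _) (⊛-comm (f ∘ suc) g k)) (sym (⊛-suc g f k))

  ⊛-identityˡ : ∀ f k → (const 1# ⊛ f) k ≈ f k
  ⊛-identityˡ f k = trans (⊛-constˡ (const 1#) f (λ _ → refl) k) (*-identityˡ _)

  seriesRing : CommutativeRing c ℓ
  seriesRing = record
    { Carrier = Series
    ; _≈_ = _≋_
    ; _+_ = _⊕_
    ; _*_ = _⊛_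
    ; -_  = λ f k → - f k
    ; 0#  = λ _ → 0#
    ; 1#  = const 1#
    ; isCommutativeRing = record
      { isRing = record
        { +-isAbelianGroup = record
          { isGroup = record
            { isMonoid = record
              { isSemigroup = record
                { isMagma = record
                  { isEquivalence = record
                    { refl  = pointwise λ _ → refl
                    ; sym   = λ p → pointwise λ k → sym (at p k)
                    ; trans = λ p q → pointwise λ k → trans (at p k) (at q k)
                    }
                  ; ∙-cong = λ p q → pointwise λ k → +-cong (at p k) (at q k)
                  }
                ; assoc = λ f g h → pointwise λ k → +-assoc _ _ _
                }
              ; identity = (λ f → pointwise λ k → +-identityˡ _) , (λ f → pointwise λ k → +-identityʳ _)
              }
            ; inverse = (λ f → pointwise λ k → -‿inverseˡ _) , (λ f → pointwise λ k → -‿inverseʳ _)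
            ; ⁻¹-cong = λ p → pointwise λ k → -‿cong (at p k)
            }
          ; comm = λ f g → pointwise λ k → +-comm _ _
          }
        ; *-cong = λ p q → pointwise (⊛-cong (at p) (at q))
        ; *-assoc = λ f g h → pointwise (⊛-assoc f g h)
        ; *-identity = (λ f → pointwise (⊛-identityˡ f))
                     , (λ f → pointwise λ k → trans (⊛-comm f (const 1#) k) (⊛-identityˡ f k))
        ; distrib = (λ h f g → pointwise λ k → trans (⊛-comm h (f ⊕ g) k)
                      (trans (⊛-distribʳ h f g k) (+-cong (⊛-comm f h k) (⊛-comm g h k))))
                  , (λ h f g → pointwise (⊛-distribʳ h f g))
        }
      ; *-comm = λ f g → pointwise (⊛-comm f g)
      }
    }

  open RawMonoidOps (CommutativeRing.+-rawMonoid seriesRing) public using () renaming (sum to ∑ˢ)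
  open Sum semiring using (sum)

  ∑ˢ-at : ∀ {n} (f : Fin n → Series) k → ∑ˢ f k ≡ sum (λ i → f i k)
  ∑ˢ-at {zero}  f k = ≡.refl
  ∑ˢ-at {suc n} f k = ≡.cong (f zero k +_) (∑ˢ-at (f ∘ suc) k)

-- Polynomials and their reversals as power series

module Reciprocal {c ℓ} (R : CommutativeRing c ℓ) where

  open CommutativeRing R hiding (zero)
  open PowerSeries R
  private module S = CommutativeRing seriesRing
  private module P = Polynomial rawRing
  open P hiding (rawRing; charPoly; _≈ᴾ_)
  open RingProperties ring using (-0#≈0#)

  coeff-+ : ∀ p q k → coeff (p +ᴾ q) k ≈ coeff p k + coeff q k
  coeff-+ []      q       k       = sym (+-identityˡ _)
  coeff-+ (a ∷ p) []      k       = sym (+-identityʳ _)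
  coeff-+ (a ∷ p) (b ∷ q) zero    = refl
  coeff-+ (a ∷ p) (b ∷ q) (suc k) = coeff-+ p q k

  coeff-scale : ∀ a p k → coeff (map (a *_) p) k ≈ a * coeff p k
  coeff-scale a []      k       = sym (zeroʳ a)
  coeff-scale a (b ∷ p) zero    = refl
  coeff-scale a (b ∷ p) (suc k) = coeff-scale a p k

  coeff-* : ∀ p q k → coeff (p *ᴾ q) k ≈ (coeff p ⊛ coeff q) k
  coeff-* []      q k       = sym (⊛-zeroˡ (coeff q) (λ _ → refl) k)
  coeff-* (a ∷ p) q zero    =
    trans (coeff-+ (map (a *_) q) _ 0) (trans (+-identityʳ _) (coeff-scale a q 0))
  coeff-* (a ∷ p) q (suc k) =
    trans (coeff-+ (map (a *_) q) _ (suc k)) (+-cong (coeff-scale a q (suc k)) (coeff-* p q k))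

  -- g = tⁿ f(1/t), where f and g have degree at most n.

  record Reversal (n : ℕ) (f g : Series) : Set ℓ where
    field
      reverse : ∀ {i j} → i ℕ.+ j ≡ n → f i ≈ g j
      degreeˡ : ∀ {k} → n ℕ.< k → f k ≈ 0#
      degreeʳ : ∀ {k} → n ℕ.< k → g k ≈ 0#

  open Reversal

  reversal-congˡ : ∀ {n f f′ g} → (∀ k → f′ k ≈ f k) → Reversal n f g → Reversal n f′ g
  reversal-congˡ f′≈f r = record
    { reverse = λ eq → trans (f′≈f _) (reverse r eq)
    ; degreeˡ = λ n<k → trans (f′≈f _) (degreeˡ r n<k)
    ; degreeʳ = degreeʳ r
    }

  reversal-0 : ∀ {n} → Reversal n (λ _ → 0#) (λ _ → 0#)
  reversal-0 = record { reverse = λ _ → refl ; degreeˡ = λ _ → refl ; degreeʳ = λ _ → refl }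

  reversal-+ : ∀ {n f f′ g g′} → Reversal n f g → Reversal n f′ g′ → Reversal n (f ⊕ f′) (g ⊕ g′)
  reversal-+ r r′ = record
    { reverse = λ eq → +-cong (reverse r eq) (reverse r′ eq)
    ; degreeˡ = λ n<k → trans (+-cong (degreeˡ r n<k) (degreeˡ r′ n<k)) (+-identityˡ 0#)
    ; degreeʳ = λ n<k → trans (+-cong (degreeʳ r n<k) (degreeʳ r′ n<k)) (+-identityˡ 0#)
    }

  -- Reversal is multiplicative when the degree bounds are added. Left factors of bound 0 and 1
  -- suffice for a Laplace expansion: signs are constants and matrix entries are linear.
  reversal-*₀ : ∀ {n a b f g} → Reversal 0 a b → Reversal n f g → Reversal n (a ⊛ f) (b ⊛ g)
  reversal-*₀ {n} {a} {b} {f} {g} s r = record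
    { reverse = λ {i} {j} eq → trans (aˡ i) (trans (*-cong (reverse s ≡.refl) (reverse r eq)) (sym (bˡ j)))
    ; degreeˡ = λ {k} n<k → trans (aˡ k) (trans (*-congˡ (degreeˡ r n<k)) (zeroʳ _))
    ; degreeʳ = λ {k} n<k → trans (bˡ k) (trans (*-congˡ (degreeʳ r n<k)) (zeroʳ _))
    }
    where
    aˡ : ∀ k → (a ⊛ f) k ≈ a 0 * f k
    aˡ = ⊛-constˡ a f λ k → degreeˡ s (s≤s z≤n)
    bˡ : ∀ k → (b ⊛ g) k ≈ b 0 * g k
    bˡ = ⊛-constˡ b g λ k → degreeʳ s (s≤s z≤n)

  reversal-*₁ : ∀ {n a b f g} → Reversal 1 a b → Reversal n f g → Reversal (suc n) (a ⊛ f) (b ⊛ g)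
  reversal-*₁ {n} {a} {b} {f} {g} s r = record
    { reverse = λ {i} {j} → flip i j
    ; degreeˡ = λ { {suc k} (s≤s n<k) → trans (aˡ k) (vanish (degreeˡ r (ℕ.m<n⇒m<1+n n<k)) (degreeˡ r n<k)) }
    ; degreeʳ = λ { {suc k} (s≤s n<k) → trans (bˡ k) (vanish (degreeʳ r (ℕ.m<n⇒m<1+n n<k)) (degreeʳ r n<k)) }
    }
    where
    vanish : ∀ {x y z w} → y ≈ 0# → w ≈ 0# → x * y + z * w ≈ 0#
    vanish y≈0 w≈0 = trans (+-cong (trans (*-congˡ y≈0) (zeroʳ _)) (trans (*-congˡ w≈0) (zeroʳ _)))
      (+-identityˡ 0#)
    aˡ : ∀ k → (a ⊛ f) (suc k) ≈ a 0 * f (suc k) + a 1 * f k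
    aˡ = ⊛-linearˡ a f λ k → degreeˡ s (s≤s (s≤s z≤n))
    bˡ : ∀ k → (b ⊛ g) (suc k) ≈ b 0 * g (suc k) + b 1 * g k
    bˡ = ⊛-linearˡ b g λ k → degreeʳ s (s≤s (s≤s z≤n))
    a₀≈b₁ : a 0 ≈ b 1
    a₀≈b₁ = reverse s ≡.refl
    a₁≈b₀ : a 1 ≈ b 0
    a₁≈b₀ = reverse s ≡.refl
    flip : ∀ i j → i ℕ.+ j ≡ suc n → (a ⊛ f) i ≈ (b ⊛ g) j
    -- At either end of the range, one of the two products on the longer side involves a coefficient
    -- of index n + 1 and vanishes by the degree bound.
    flip zero    (suc j) ≡.refl = sym (trans (bˡ j) (trans (+-congʳ
      (trans (*-congˡ (degreeʳ r ℕ.≤-refl)) (zeroʳ _)))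
      (trans (+-identityˡ _) (*-cong (sym a₀≈b₁) (sym (reverse r ≡.refl))))))
    flip (suc i) zero    eq = trans (aˡ i) (trans (+-congʳ
      (trans (*-congˡ (degreeˡ r (ℕ.≤-reflexive (≡.sym i+1≡n+1)))) (zeroʳ _)))
      (trans (+-identityˡ _) (*-cong a₁≈b₀ (reverse r (ℕ.suc-injective eq)))))
      where
      i+1≡n+1 : suc i ≡ suc n
      i+1≡n+1 = ≡.trans (≡.sym (ℕ.+-identityʳ (suc i))) eq
    flip (suc i) (suc j) eq = trans (aˡ i) (trans (+-comm _ _) (trans
      (+-cong (*-cong a₁≈b₀ (reverse r (ℕ.suc-injective eq)))
              (*-cong a₀≈b₁ (reverse r (≡.trans (≡.sym (ℕ.+-suc i j)) (ℕ.suc-injective eq)))))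
      (sym (bˡ j))))

  open RawMonoidOps (RawRing.+-rawMonoid P.rawRing)
    using () renaming (sum to ∑ᴾ)
  open RawSemiringOps (RawRing.rawSemiring P.rawRing)
    using () renaming (_^_ to _^ᴾ_)
  open RawSemiringOps (RawRing.rawSemiring S.rawRing) using () renaming (_^_ to _^ˢ_)
  open Determinant P.rawRing using () renaming (det to detᴾ)
  open Determinant S.rawRing using () renaming (det to detˢ)

  reversal-∑ : ∀ {m n} (p : Fin m → Poly) (f : Fin m → Series) →
    (∀ i → Reversal n (coeff (p i)) (f i)) → Reversal n (coeff (∑ᴾ p)) (∑ˢ f)
  reversal-∑ {zero}  p f r = reversal-0
  reversal-∑ {suc m} p f r = reversal-congˡ (coeff-+ (p zero) _)
    (reversal-+ (r zero) (reversal-∑ (p ∘ suc) (f ∘ suc) (r ∘ suc)))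

  reversal-const : ∀ a → Reversal 0 (coeff (constᴾ a)) (const a)
  reversal-const a = record
    { reverse = λ { {zero} {zero} _ → refl }
    ; degreeˡ = λ { {suc k} _ → refl }
    ; degreeʳ = λ { {suc k} _ → refl }
    }

  reversal-sign : ∀ e → Reversal 0 (coeff (map -_ (constᴾ 1#) ^ᴾ e)) ((S.- S.1#) ^ˢ e)
  reversal-sign zero    = reversal-const 1#
  reversal-sign (suc e) = reversal-congˡ (coeff-* (map -_ (constᴾ 1#)) (map -_ (constᴾ 1#) ^ᴾ e))
    (reversal-*₀ minus-one (reversal-sign e))
    where
    minus-one : Reversal 0 (coeff (map -_ (constᴾ 1#))) (S.- S.1#)
    minus-one = record
      { reverse = λ { {zero} {zero} _ → refl }
      ; degreeˡ = λ { {suc k} _ → refl }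
      ; degreeʳ = λ { {suc k} _ → -0#≈0# }
      }

  reversal-det : ∀ n (P : Matrix Poly n) (F : Matrix Series n) →
    (∀ i j → Reversal 1 (coeff (P i j)) (F i j)) → Reversal n (coeff (detᴾ n P)) (detˢ n F)
  reversal-det zero    P F r = reversal-const 1#
  reversal-det (suc n) P F r = reversal-∑ (λ j → signᴾ j *ᴾ (P zero j *ᴾ dᴾ j)) _ λ j →
    reversal-congˡ (coeff-* (signᴾ j) (P zero j *ᴾ dᴾ j)) (reversal-*₀ (reversal-sign (toℕ j))
      (reversal-congˡ (coeff-* (P zero j) (dᴾ j)) (reversal-*₁ (r zero j)
        (reversal-det n (λ i k → P (suc i) (punchIn j k)) _ λ i k → r (suc i) (punchIn j k)))))
    where
    signᴾ dᴾ : Fin (suc n) → Poly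
    signᴾ j = map -_ (constᴾ 1#) ^ᴾ toℕ j
    dᴾ j = detᴾ n λ i k → P (suc i) (punchIn j k)

-- Closed walks and the reciprocal of det (I - t M)

module CharacteristicSeries {c ℓ} (R : CommutativeRing c ℓ) where

  open CommutativeRing R hiding (zero)
  open PowerSeries R
  open Reciprocal R
  open Reversal
  private module S = CommutativeRing seriesRing
  private module P = Polynomial rawRing
  open RingProperties ring using (-0#≈0#; -‿distribˡ-*; -‿+-comm)
  open SetoidReasoning setoid
  open Sum semiring
  open LaplaceExpansion seriesRing using (cramer) renaming (det-cong to detˢ-cong)
  open LaplaceExpansion R using (sum-zero)
  open Determinant S.rawRing

  δ : ∀ {n} → Fin n → Fin n → Carrier
  δ i j = if ⌊ i Fin.≟ j ⌋ then 1# else 0#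

  δ-suc : ∀ {n} (i j : Fin n) → δ (suc i) (suc j) ≡ δ i j
  δ-suc i j with i Fin.≟ j
  ... | yes _ = ≡.refl
  ... | no  _ = ≡.refl

  sum-δ : ∀ {n} (f : Fin n → Carrier) j → (sum λ i → f i * δ i j) ≈ f j
  sum-δ f zero = trans (+-cong (*-identityʳ _) (sum-zero (λ i → f (suc i) * 0#) λ i → zeroʳ _)) (+-identityʳ _)
  sum-δ f (suc j) = trans (+-cong (zeroʳ _) (sum-δ′ (f ∘ suc) j)) (+-identityˡ _)
    where
    sum-δ′ : ∀ {n} (f : Fin n → Carrier) j → (sum λ i → f i * δ (suc i) (suc j)) ≈ f j
    sum-δ′ f j = trans (sum-cong-≋ λ i → *-congˡ {x = f i} (reflexive (δ-suc i j))) (sum-δ f j)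

  linear : Carrier → Carrier → Series
  linear a b 0             = a
  linear a b 1             = b
  linear a b (suc (suc _)) = 0#

  -- The entries of I − t M.

  pencil : ∀ {n} → Matrix Carrier n → Matrix Series n
  pencil M i j = linear (δ i j) (- M i j)

  charSeries : ∀ n → Matrix Carrier n → Series
  charSeries n M = det n (pencil M)

  -- This is det (I - t M) = tⁿ det (t⁻¹ I - M). Every entry is reversed with bound 1, even the
  -- constant ones off the diagonal, so that -m becomes -m t.
  charPoly-reversal : ∀ n (M : Matrix Carrier n) → Reversal n (P.coeff (P.charPoly M)) (charSeries n M)
  charPoly-reversal n M = reversal-det n _ (pencil M) λ i j → entry ⌊ i Fin.≟ j ⌋ (M i j)
    where
    entry : ∀ b m → Reversal 1 (P.coeff ((if b then P.X else []) P.+ᴾ map -_ (P.constᴾ m)))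
                               (linear (if b then 1# else 0#) (- m))
    entry true m = record
      { reverse = λ { {0} {1} _ → +-identityˡ _ ; {1} {0} _ → refl ; {1} {suc _} () ; {suc (suc _)} () }
      ; degreeˡ = λ { {suc (suc k)} _ → refl ; {1} (s≤s ()) }
      ; degreeʳ = λ { {suc (suc k)} _ → refl ; {1} (s≤s ()) }
      }
    entry false m = record
      { reverse = λ { {0} {1} _ → refl ; {1} {0} _ → refl ; {1} {suc _} () ; {suc (suc _)} () }
      ; degreeˡ = λ { {suc (suc k)} _ → refl ; {1} (s≤s ()) }
      ; degreeʳ = λ { {suc (suc k)} _ → refl ; {1} (s≤s ()) }
      }

  -- The coefficient of tᵏ is (Mᵏ)₀ᵢ.

  walks : ∀ {n} → Matrix Carrier (suc n) → Fin (suc n) → Series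
  walks M i zero    = δ zero i
  walks M i (suc k) = sum λ l → walks M l k * M l i

  deleteFirst : ∀ {n} → Matrix Carrier (suc n) → Matrix Carrier n
  deleteFirst M i j = M (suc i) (suc j)

  -- Row 0 of (Σₖ Mᵏ tᵏ)(I - t M) = I: the geometric series telescopes, coefficient k + 1 being Mᵏ⁺¹
  -- - Mᵏ M.
  walks-pencil : ∀ {n} (M : Matrix Carrier (suc n)) j k →
    (sum λ i → (walks M i ⊛ pencil M i j) k) ≈ const (δ zero j) k
  walks-pencil M j zero    = sum-δ (δ zero) j
  walks-pencil M j (suc k) = begin
    (sum λ i → (walks M i ⊛ pencil M i j) (suc k))
      ≈⟨ sum-cong-≋ (λ i → trans (⊛-comm (walks M i) (pencil M i j) (suc k))
           (trans (⊛-linearˡ (pencil M i j) (walks M i) (λ _ → refl) k)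
             (+-cong (*-comm _ _) (trans (sym (-‿distribˡ-* _ _)) (-‿cong (*-comm _ _)))))) ⟩
    (sum λ i → walks M i (suc k) * δ i j + - (walks M i k * M i j))
      ≈⟨ ∑-distrib-+ (λ i → walks M i (suc k) * δ i j) (λ i → - (walks M i k * M i j)) ⟩
    (sum λ i → walks M i (suc k) * δ i j) + (sum λ i → - (walks M i k * M i j))
      ≈⟨ +-cong (sum-δ (λ i → walks M i (suc k)) j) (sum-neg λ i → walks M i k * M i j) ⟩
    walks M j (suc k) + - walks M j (suc k)
      ≈⟨ -‿inverseʳ _ ⟩
    0# ∎
    where
    sum-neg : ∀ {n} (f : Fin n → Carrier) → (sum λ i → - f i) ≈ - sum f
    sum-neg {zero}  f = sym -0#≈0#
    sum-neg {suc n} f = trans (+-congˡ (sum-neg (f ∘ suc))) (-‿+-comm _ _)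

  closedWalks-charSeries : ∀ n (M : Matrix Carrier (suc n)) →
    (walks M zero ⊛ charSeries (suc n) M) ≋ charSeries n (deleteFirst M)
  closedWalks-charSeries n M = S.trans
    (cramer n (walks M) (pencil M) (column zero) λ j →
      S.trans (column (suc j)) (pointwise λ { zero → refl ; (suc _) → refl }))
    (detˢ-cong n λ i j → pointwise λ { 0 → reflexive (δ-suc i j) ; 1 → refl ; (suc (suc _)) → refl })
    where
    column : ∀ j → ∑ˢ (λ i → walks M i ⊛ pencil M i j) ≋ const (δ zero j)
    column j = pointwise λ k → trans (reflexive (∑ˢ-at (λ i → walks M i ⊛ pencil M i j) k)) (walks-pencil M j k)

  -- The coefficients of 1 / det (I − t M): the complete homogeneous
  -- symmetric functions of the eigenvalues.

  complete : ∀ n → Matrix Carrier n → Series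
  complete zero    M = const 1#
  complete (suc n) M = walks M zero ⊛ complete n (deleteFirst M)

  charSeries-complete : ∀ n (M : Matrix Carrier n) → (charSeries n M ⊛ complete n M) ≋ const 1#
  charSeries-complete zero    M = S.*-identityˡ _
  charSeries-complete (suc n) M = S.trans (S.sym (S.*-assoc _ _ _))
    (S.trans (S.*-congʳ (S.trans (S.*-comm _ _) (closedWalks-charSeries n M)))
      (charSeries-complete n (deleteFirst M)))

  inverse-unique : ∀ {f g h} → f ⊛ g ≋ const 1# → f ⊛ h ≋ const 1# → g ≋ h
  inverse-unique {f} {g} {h} fg≋1 fh≋1 = S.trans (S.sym (S.*-identityʳ g))
    (S.trans (S.*-congˡ (S.sym fh≋1)) (S.trans (S.sym (S.*-assoc g f h))
      (S.trans (S.*-congʳ (S.trans (S.*-comm g f) fg≋1)) (S.*-identityˡ h))))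

  module _ {n} (M N : Matrix Carrier n) where

    charPoly⇒complete : P.charPoly M P.≈ᴾ P.charPoly N → complete n M ≋ complete n N
    charPoly⇒complete M≈N = inverse-unique (charSeries-complete n M)
      (S.trans (S.*-congʳ (pointwise charSeries≈)) (charSeries-complete n N))
      where
      charSeries≈ : ∀ k → charSeries n M k ≈ charSeries n N k
      -- Reversal matches coefficients only up to the degree bound; above it both series vanish.
      charSeries≈ k with k ℕ.≤? n
      ... | yes k≤n = let eq = ℕ.m∸n+n≡m k≤n in
        trans (sym (reverse (charPoly-reversal n M) eq))
          (trans (M≈N (n ℕ.∸ k)) (reverse (charPoly-reversal n N) eq))
      ... | no  k≰n = trans (degreeʳ (charPoly-reversal n M) (ℕ.≰⇒> k≰n))
        (sym (degreeʳ (charPoly-reversal n N) (ℕ.≰⇒> k≰n)))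

    complete⇒charPoly : complete n M ≋ complete n N → P.charPoly M P.≈ᴾ P.charPoly N
    complete⇒charPoly M≋N k with k ℕ.≤? n
    ... | yes k≤n = let eq = ℕ.m+[n∸m]≡n k≤n in
      trans (reverse (charPoly-reversal n M) eq)
        (trans (at charSeries≋ (n ℕ.∸ k)) (sym (reverse (charPoly-reversal n N) eq)))
      where
      charSeries≋ : charSeries n M ≋ charSeries n N
      charSeries≋ = inverse-unique
        (S.trans (S.*-comm _ _) (charSeries-complete n M))
        (S.trans (S.*-comm _ _) (S.trans (S.*-congˡ M≋N) (charSeries-complete n N)))
    ... | no  k≰n = trans (degreeˡ (charPoly-reversal n M) (ℕ.≰⇒> k≰n))
      (sym (degreeˡ (charPoly-reversal n N) (ℕ.≰⇒> k≰n)))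

-- Order on the reals

private module ≈ᴿ = IsEquivalence ≈ᴿ-isEquivalence

infix 4 _≤ᴿ_

-- The one-sided form of `_∼ˢ_`: two opposite inequalities recombine into the absolute value that
-- defines equality, without deciding anything about reals.
record _≤ᴿ_ (a b : ℝ) : Set where
  field
    excess : ∀ ε → 0ℚ ℚ.< ε →
      ∃ λ N → ∀ m n → N ℕ.≤ m → N ℕ.≤ n → seq a m ℚ.- seq b n ℚ.< ε

open _≤ᴿ_

module RationalLemmas where
  open +-*-Solver using (solve; _:+_; _:*_; :-_; _:-_; _:=_; con)

  half-pos : ∀ {ε} → 0ℚ ℚ.< ε → 0ℚ ℚ.< ½ ℚ.* ε
  half-pos {ε} 0<ε = ≡.subst (ℚ._< ½ ℚ.* ε) (ℚ.*-zeroʳ ½) (ℚ.*-monoʳ-<-pos ½ 0<ε)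

  half+half : ∀ ε → ½ ℚ.* ε ℚ.+ ½ ℚ.* ε ≡ ε
  half+half ε = ≡.trans (≡.sym (ℚ.*-distribʳ-+ ε ½ ½)) (ℚ.*-identityˡ ε)

  +-half-< : ∀ {ε} p q → p ℚ.< ½ ℚ.* ε → q ℚ.< ½ ℚ.* ε → p ℚ.+ q ℚ.< ε
  +-half-< {ε} p q p< q< = ≡.subst (p ℚ.+ q ℚ.<_) (half+half ε) (ℚ.+-mono-< p< q<)

  p≤∣p∣ : ∀ p → p ℚ.≤ ∣ p ∣
  p≤∣p∣ p with 0ℚ ℚ.≤? p
  ... | yes 0≤p = ℚ.≤-reflexive (≡.sym (ℚ.0≤p⇒∣p∣≡p 0≤p))
  ... | no  0≰p = ℚ.≤-trans (ℚ.<⇒≤ (ℚ.≰⇒> 0≰p)) (ℚ.0≤∣p∣ p)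

  ∣p∣< : ∀ {ε} p → p ℚ.< ε → ℚ.- p ℚ.< ε → ∣ p ∣ ℚ.< ε
  ∣p∣< {ε} p p< -p< with ℚ.∣p∣≡p∨∣p∣≡-p p
  ... | inj₁ eq = ≡.subst (ℚ._< ε) (≡.sym eq) p<
  ... | inj₂ eq = ≡.subst (ℚ._< ε) (≡.sym eq) -p<

  telescope : ∀ p q r → (p ℚ.- q) ℚ.+ (q ℚ.- r) ≡ p ℚ.- r
  telescope = solve 3 (λ p q r → (p :- q) :+ (q :- r) := p :- r) ≡.refl

  regroup : ∀ p p′ q q′ → (p ℚ.- p′) ℚ.+ (q ℚ.- q′) ≡ (p ℚ.+ q) ℚ.- (p′ ℚ.+ q′)
  regroup = solve 4 (λ p p′ q q′ → (p :- p′) :+ (q :- q′) := (p :+ q) :- (p′ :+ q′)) ≡.refl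

  flip : ∀ p q → p ℚ.- q ≡ ℚ.- (q ℚ.- p)
  flip = solve 2 (λ p q → p :- q := :- (q :- p)) ≡.refl

  p+q-q≡p : ∀ p q → (p ℚ.+ q) ℚ.- q ≡ p
  p+q-q≡p = solve 2 (λ p q → (p :+ q) :- q := p) ≡.refl

  p+q-p≡q : ∀ p q → (p ℚ.+ q) ℚ.- p ≡ q
  p+q-p≡q = solve 2 (λ p q → (p :+ q) :- p := q) ≡.refl

  p-q+q≡p : ∀ p q → (p ℚ.- q) ℚ.+ q ≡ p
  p-q+q≡p = solve 2 (λ p q → (p :- q) :+ q := p) ≡.refl

  p-0≡p : ∀ p → p ℚ.- 0ℚ ≡ p
  p-0≡p = solve 1 (λ p → p :- con 0ℚ := p) ≡.refl

  conj-product-re : ∀ p q → p ℚ.* p ℚ.- (ℚ.- q) ℚ.* q ≡ p ℚ.* p ℚ.+ q ℚ.* q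
  conj-product-re = solve 2 (λ p q → p :* p :- (:- q) :* q := p :* p :+ q :* q) ≡.refl

  conj-product-im : ∀ p q → p ℚ.* q ℚ.+ (ℚ.- q) ℚ.* p ≡ 0ℚ
  conj-product-im = solve 2 (λ p q → p :* q :+ (:- q) :* p := con 0ℚ) ≡.refl

  0≤p*p : ∀ p → 0ℚ ℚ.≤ p ℚ.* p
  0≤p*p p with ℚ.∣p∣≡p∨∣p∣≡-p p
  ... | inj₁ eq = ℚ.nonNegative⁻¹ (p ℚ.* p) {{ℚ.nonNeg*nonNeg⇒nonNeg p {{p≥0}} p {{p≥0}}}}
    where
    p≥0 : ℚ.NonNegative p
    p≥0 = ℚ.nonNegative (ℚ.∣p∣≡p⇒0≤p eq)
  ... | inj₂ eq = ≡.subst (0ℚ ℚ.≤_) (≡.trans (≡.cong₂ ℚ._*_ eq eq) (neg-square p))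
    (ℚ.nonNegative⁻¹ (∣ p ∣ ℚ.* ∣ p ∣)
      {{ℚ.nonNeg*nonNeg⇒nonNeg (∣ p ∣) {{ℚ.∣-∣-nonNeg p}} (∣ p ∣) {{ℚ.∣-∣-nonNeg p}}}})
    where
    neg-square : ∀ p → (ℚ.- p) ℚ.* (ℚ.- p) ≡ p ℚ.* p
    neg-square = solve 1 (λ p → (:- p) :* (:- p) := p :* p) ≡.refl

  square-≤ : ∀ {p q} → 0ℚ ℚ.≤ p → p ℚ.≤ q → p ℚ.* p ℚ.≤ q ℚ.* q
  square-≤ {p} {q} 0≤p p≤q = ℚ.≤-trans
    (ℚ.*-monoʳ-≤-nonNeg p {{ℚ.nonNegative 0≤p}} p≤q)
    (ℚ.*-monoˡ-≤-nonNeg q {{ℚ.nonNegative (ℚ.≤-trans 0≤p p≤q)}} p≤q)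

  -- If a ≥ 1 + ε, then a² + b² ≥ a² ≥ a ≥ 1 + ε. The bound a² ≥ a lets the tolerance carry over
  -- unchanged, without square roots.
  circle-coordinate : ∀ {ε} a b → 0ℚ ℚ.< ε →
    ∣ (a ℚ.* a ℚ.+ b ℚ.* b) ℚ.- 1ℚ ∣ ℚ.< ε → a ℚ.- 1ℚ ℚ.< ε
  circle-coordinate {ε} a b 0<ε close with a ℚ.- 1ℚ ℚ.<? ε
  ... | yes a-1<ε = a-1<ε
  ... | no  a-1≮ε = contradiction (ℚ.<-≤-trans close (ℚ.≤-trans
        (ℚ.≤-trans ε≤a-1 (ℚ.+-monoˡ-≤ (ℚ.- 1ℚ) a≤a²+b²)) (p≤∣p∣ _))) (ℚ.<-irrefl ≡.refl)
    where
    ε≤a-1 : ε ℚ.≤ a ℚ.- 1ℚ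
    ε≤a-1 = ℚ.≮⇒≥ a-1≮ε
    1≤a : 1ℚ ℚ.≤ a
    1≤a = ≡.subst₂ ℚ._≤_ (ℚ.+-identityˡ 1ℚ) (p-q+q≡p a 1ℚ)
      (ℚ.+-monoˡ-≤ 1ℚ (ℚ.≤-trans (ℚ.<⇒≤ 0<ε) ε≤a-1))
    a≤a²+b² : a ℚ.≤ a ℚ.* a ℚ.+ b ℚ.* b
    a≤a²+b² = ≡.subst (ℚ._≤ a ℚ.* a ℚ.+ b ℚ.* b)
      (≡.trans (ℚ.+-identityʳ (a ℚ.* 1ℚ)) (ℚ.*-identityʳ a))
      (ℚ.+-mono-≤ (ℚ.*-monoˡ-≤-nonNeg a {{ℚ.nonNegative (ℚ.≤-trans (ℚ.<⇒≤ (ℚ.positive⁻¹ 1ℚ)) 1≤a)}} 1≤a)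
        (0≤p*p b))

  square-small : ∀ {ε} p → 0ℚ ℚ.< ε → ∣ p ℚ.* p ∣ ℚ.< ε ℚ.* ε → ∣ p ∣ ℚ.< ε
  square-small {ε} p 0<ε p²<ε² with ∣ p ∣ ℚ.<? ε
  ... | yes p<ε = p<ε
  ... | no  p≮ε = contradiction (ℚ.<-≤-trans p²<ε² (≡.subst (ε ℚ.* ε ℚ.≤_)
        (≡.sym (ℚ.∣p*q∣≡∣p∣*∣q∣ p p)) (square-≤ (ℚ.<⇒≤ 0<ε) (ℚ.≮⇒≥ p≮ε)))) (ℚ.<-irrefl ≡.refl)

open RationalLemmas

≈⇒≤ : ∀ {a b} → a ≈ᴿ b → a ≤ᴿ b
≈⇒≤ (mk≈ᴿ a∼b) .excess ε 0<ε with within a∼b ε 0<ε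
... | N , close = N , λ m n N≤m N≤n → ℚ.≤-<-trans (p≤∣p∣ _) (close m n N≤m N≤n)

≤ᴿ-trans : ∀ {a b c} → a ≤ᴿ b → b ≤ᴿ c → a ≤ᴿ c
≤ᴿ-trans {a} {b} {c} a≤b b≤c .excess ε 0<ε
  with excess a≤b (½ ℚ.* ε) (half-pos 0<ε) | excess b≤c (½ ℚ.* ε) (half-pos 0<ε)
... | N₁ , small₁ | N₂ , small₂ = N₁ ℕ.⊔ N₂ , λ m n N≤m N≤n →
  let k = N₁ ℕ.⊔ N₂ in
  ≡.subst (ℚ._< ε) (telescope (seq a m) (seq b k) (seq c n))
    (+-half-< (seq a m ℚ.- seq b k) (seq b k ℚ.- seq c n)
      (small₁ m k (ℕ.m⊔n≤o⇒m≤o N₁ N₂ N≤m) (ℕ.m≤m⊔n N₁ N₂))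
      (small₂ k n (ℕ.m≤n⊔m N₁ N₂) (ℕ.m⊔n≤o⇒n≤o N₁ N₂ N≤n)))

+ᴿ-mono-≤ : ∀ {a a′ b b′} → a ≤ᴿ a′ → b ≤ᴿ b′ → a +ᴿ b ≤ᴿ a′ +ᴿ b′
+ᴿ-mono-≤ {a} {a′} {b} {b′} a≤a′ b≤b′ .excess ε 0<ε
  with excess a≤a′ (½ ℚ.* ε) (half-pos 0<ε) | excess b≤b′ (½ ℚ.* ε) (half-pos 0<ε)
... | N₁ , small₁ | N₂ , small₂ = N₁ ℕ.⊔ N₂ , λ m n N≤m N≤n →
  ≡.subst (ℚ._< ε) (regroup (seq a m) (seq a′ n) (seq b m) (seq b′ n))
    (+-half-< (seq a m ℚ.- seq a′ n) (seq b m ℚ.- seq b′ n)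
      (small₁ m n (ℕ.m⊔n≤o⇒m≤o N₁ N₂ N≤m) (ℕ.m⊔n≤o⇒m≤o N₁ N₂ N≤n))
      (small₂ m n (ℕ.m⊔n≤o⇒n≤o N₁ N₂ N≤m) (ℕ.m⊔n≤o⇒n≤o N₁ N₂ N≤n)))

≤ᴿ-antisym : ∀ {a b} → a ≤ᴿ b → b ≤ᴿ a → a ≈ᴿ b
≤ᴿ-antisym {a} {b} a≤b b≤a .approach .within ε 0<ε with excess a≤b ε 0<ε | excess b≤a ε 0<ε
... | N₁ , small₁ | N₂ , small₂ = N₁ ℕ.⊔ N₂ , λ m n N≤m N≤n →
  ∣p∣< (seq a m ℚ.- seq b n)
    (small₁ m n (ℕ.m⊔n≤o⇒m≤o N₁ N₂ N≤m) (ℕ.m⊔n≤o⇒m≤o N₁ N₂ N≤n))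
    (≡.subst (ℚ._< ε) (flip (seq b n) (seq a m))
      (small₂ n m (ℕ.m⊔n≤o⇒n≤o N₁ N₂ N≤n) (ℕ.m⊔n≤o⇒n≤o N₁ N₂ N≤m)))

+ᴿ-cancelʳ-≤ : ∀ {a b} c → a +ᴿ c ≤ᴿ b +ᴿ c → a ≤ᴿ b
+ᴿ-cancelʳ-≤ {a} {b} c a+c≤b+c = ≤ᴿ-trans
  (≈⇒≤ (≈ᴿ.sym (≗⇒≈ᴿ (a +ᴿ c -ᴿ c) a λ n → p+q-q≡p (seq a n) (seq c n))))
  (≤ᴿ-trans (+ᴿ-mono-≤ a+c≤b+c (≈⇒≤ ≈ᴿ.refl))
    (≈⇒≤ (≗⇒≈ᴿ (b +ᴿ c -ᴿ c) b λ n → p+q-q≡p (seq b n) (seq c n))))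

square≈0⇒≈0 : ∀ {a} → a *ᴿ a ≈ᴿ 0ᴿ → a ≈ᴿ 0ᴿ
square≈0⇒≈0 {a} (mk≈ᴿ a²∼0) .approach .within ε 0<ε
  with within a²∼0 (ε ℚ.* ε) (≡.subst (ℚ._< ε ℚ.* ε) (ℚ.*-zeroʳ ε) (ℚ.*-monoʳ-<-pos ε {{ℚ.positive 0<ε}} 0<ε))
... | N , close = N , λ m n N≤m N≤n → ≡.subst (λ p → ∣ p ∣ ℚ.< ε) (≡.sym (p-0≡p (seq a m)))
  (square-small (seq a m) 0<ε (≡.subst (λ p → ∣ p ∣ ℚ.< ε ℚ.* ε) (p-0≡p _) (close m n N≤m N≤n)))

re-unit≤1 : ∀ u → re (val u) ≤ᴿ 1ᴿ
re-unit≤1 u .excess ε 0<ε with within (approach (unit u)) ε 0<ε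
... | N , close = N , λ m n N≤m N≤n →
  circle-coordinate (seq (re (val u)) m) (seq (im (val u)) m) 0<ε (close m n N≤m N≤n)

-- Once the real part is 1, the square of the imaginary part is ∣u∣² - 1 = 0.
re-unit≥1⇒≈1 : ∀ u → 1ᴿ ≤ᴿ re (val u) → u ≈ᵀ 1ᵀ
re-unit≥1⇒≈1 u 1≤re = mk≈ᶜ re≈1 (square≈0⇒≈0
  (≈ᴿ.trans (≈ᴿ.sym (≗⇒≈ᴿ (∣ val u ∣² -ᴿ re (val u) *ᴿ re (val u)) _ λ n →
      p+q-p≡q (seq (re (val u)) n ℚ.* seq (re (val u)) n) _))
    (≈ᴿ.trans (+ᴿ-cong (unit u) (-ᴿ-cong (*ᴿ-cong re≈1 re≈1)))
      (≗⇒≈ᴿ (1ᴿ -ᴿ 1ᴿ *ᴿ 1ᴿ) 0ᴿ λ _ → ≡.refl))))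
  where
  re≈1 : re (val u) ≈ᴿ 1ᴿ
  re≈1 = ≤ᴿ-antisym (re-unit≤1 u) 1≤re

-- Sums of units

open CommutativeRing ℂ-commutativeRing hiding (zero)
open PowerSeries ℂ-commutativeRing
open CharacteristicSeries ℂ-commutativeRing
open Sum semiring using (sum; sum-cong-≋; *-distribˡ-sum)
open SemiringSolver commutativeSemiring using (solve; _:+_; _:*_; _:=_)
open SetoidReasoning setoid

infix 4 _⊴_

-- z is a sum of units and w is the number of its terms.

data _⊴_ (z w : ℂ) : Set where
  none : z ≈ 0# → w ≈ 0# → z ⊴ w
  more : ∀ u {z′ w′} → z′ ⊴ w′ → z ≈ val u + z′ → w ≈ 1# + w′ → z ⊴ w

-- `_⊴_` only asserts that some units add up to z. Here a prescribed unit `u` is known to be among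
-- them, moved to the front so that it can be isolated.
record HasSummand (u : 𝕋) (z w : ℂ) : Set where
  constructor summand
  field
    {z′ w′} : ℂ
    rest    : z′ ⊴ w′
    z-split : z ≈ val u + z′
    w-split : w ≈ 1# + w′

⊴-resp-≈ : ∀ {z z′ w w′} → z ≈ z′ → w ≈ w′ → z′ ⊴ w′ → z ⊴ w
⊴-resp-≈ z≈ w≈ (none p q)     = none (trans z≈ p) (trans w≈ q)
⊴-resp-≈ z≈ w≈ (more u r p q) = more u r (trans z≈ p) (trans w≈ q)

0⊴0 : 0# ⊴ 0#
0⊴0 = none refl refl

unit⊴1 : ∀ u → val u ⊴ 1#
unit⊴1 u = more u 0⊴0 (sym (+-identityʳ _)) (sym (+-identityʳ _))

+-⊴ : ∀ {z z′ w w′} → z ⊴ w → z′ ⊴ w′ → z + z′ ⊴ w + w′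
+-⊴ (none p q)     s = ⊴-resp-≈ (trans (+-congʳ p) (+-identityˡ _)) (trans (+-congʳ q) (+-identityˡ _)) s
+-⊴ (more u r p q) s = more u (+-⊴ r s)
  (trans (+-congʳ p) (+-assoc _ _ _)) (trans (+-congʳ q) (+-assoc _ _ _))

unit*-⊴ : ∀ u {z w} → z ⊴ w → val u * z ⊴ w
unit*-⊴ u (none p q)     = none (trans (*-congˡ p) (zeroʳ _)) q
unit*-⊴ u (more v r p q) = more (u *ᵀ v) (unit*-⊴ u r) (trans (*-congˡ p) (distribˡ _ _ _)) q

*-⊴ : ∀ {z z′ w w′} → z ⊴ w → z′ ⊴ w′ → z * z′ ⊴ w * w′
*-⊴ (none p q)     s = none (trans (*-congʳ p) (zeroˡ _)) (trans (*-congʳ q) (zeroˡ _))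
*-⊴ (more u r p q) s = ⊴-resp-≈
  (trans (*-congʳ p) (distribʳ _ _ _))
  (trans (*-congʳ q) (trans (distribʳ _ _ _) (+-congʳ (*-identityˡ _))))
  (+-⊴ (unit*-⊴ u s) (*-⊴ r s))

sum-⊴ : ∀ {n} (f g : Fin n → ℂ) → (∀ i → f i ⊴ g i) → sum f ⊴ sum g
sum-⊴ {zero}  f g f⊴g = 0⊴0
sum-⊴ {suc n} f g f⊴g = +-⊴ (f⊴g zero) (sum-⊴ (f ∘ suc) (g ∘ suc) (f⊴g ∘ suc))

summand-resp-≈ : ∀ {u v z w} → u ≈ᵀ v → HasSummand u z w → HasSummand v z w
summand-resp-≈ u≈v (summand r p q) = summand r (trans p (+-congʳ u≈v)) q

summand-unit : ∀ u → HasSummand u (val u) 1#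
summand-unit u = summand 0⊴0 (sym (+-identityʳ _)) (sym (+-identityʳ _))

summand-+ˡ : ∀ {u z z′ w w′} → HasSummand u z w → z′ ⊴ w′ → HasSummand u (z + z′) (w + w′)
summand-+ˡ (summand r p q) s = summand (+-⊴ r s)
  (trans (+-congʳ p) (+-assoc _ _ _)) (trans (+-congʳ q) (+-assoc _ _ _))

summand-+ʳ : ∀ {u z z′ w w′} → z′ ⊴ w′ → HasSummand u z w → HasSummand u (z′ + z) (w′ + w)
summand-+ʳ s h = let summand r p q = summand-+ˡ h s in
  summand r (trans (+-comm _ _) p) (trans (+-comm _ _) q)

summand-sum : ∀ {u n} (f g : Fin n → ℂ) → (∀ i → f i ⊴ g i) →
  ∀ i → HasSummand u (f i) (g i) → HasSummand u (sum f) (sum g)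
summand-sum f g f⊴g zero    h = summand-+ˡ h (sum-⊴ (f ∘ suc) (g ∘ suc) (f⊴g ∘ suc))
summand-sum f g f⊴g (suc i) h =
  summand-+ʳ (f⊴g zero) (summand-sum (f ∘ suc) (g ∘ suc) (f⊴g ∘ suc) i h)

summand-* : ∀ {u v z z′ w w′} → HasSummand u z w → HasSummand v z′ w′ →
  HasSummand (u *ᵀ v) (z * z′) (w * w′)
summand-* {u} {v} (summand {z₁} {w₁} r p q) (summand {z₂} {w₂} s p′ q′) = summand
  -- The product is regrouped as (u + z₁)(v + z₂) = u v + (u z₂ + z₁ (v + z₂)); `more` puts the
  -- second factor back together.
  (+-⊴ (unit*-⊴ u s) (*-⊴ r (more v s p′ q′)))
  (trans (*-congʳ p) (trans (distribʳ _ _ _)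
    (trans (+-congʳ (trans (*-congˡ p′) (distribˡ _ _ _))) (+-assoc _ _ _))))
  (trans (*-congʳ q) (trans (distribʳ _ _ _)
    (trans (+-congʳ (trans (*-identityˡ _) q′)) (+-assoc _ _ _))))

⊴⇒re-≤ : ∀ {z w} → z ⊴ w → re z ≤ᴿ re w
⊴⇒re-≤ (none p q)     = ≈⇒≤ (re-≈ (trans p (sym q)))
⊴⇒re-≤ (more u r p q) = ≤ᴿ-trans (≈⇒≤ (re-≈ p))
  (≤ᴿ-trans (+ᴿ-mono-≤ (re-unit≤1 u) (⊴⇒re-≤ r)) (≈⇒≤ (re-≈ (sym q))))

-- On real parts, 1 + re w′ = re u + re z′ ≤ re u + re w′, hence re u ≥ 1, and a unit with this
-- property is 1.
summand-tight : ∀ {u z w} → HasSummand u z w → z ≈ w → u ≈ᵀ 1ᵀ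
summand-tight {u} (summand {z′} {w′} r p q) z≈w = re-unit≥1⇒≈1 u (+ᴿ-cancelʳ-≤ (re w′)
  (≤ᴿ-trans (≈⇒≤ (re-≈ (trans (sym q) (trans (sym z≈w) p))))
    (+ᴿ-mono-≤ (≈⇒≤ ≈ᴿ.refl) (⊴⇒re-≤ r))))

⊛-⊴ : ∀ {f f′ g g′} → (∀ k → f k ⊴ f′ k) → (∀ k → g k ⊴ g′ k) → ∀ k → (f ⊛ g) k ⊴ (f′ ⊛ g′) k
⊛-⊴ f⊴ g⊴ zero    = *-⊴ (f⊴ 0) (g⊴ 0)
⊛-⊴ f⊴ g⊴ (suc k) = +-⊴ (*-⊴ (f⊴ 0) (g⊴ (suc k))) (⊛-⊴ (f⊴ ∘ suc) g⊴ k)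

-- The summand comes from the product of fₖ and g₀, which is one term of coefficient k.
summand-⊛ : ∀ {u v f f′ g g′} → (∀ k → f k ⊴ f′ k) → (∀ k → g k ⊴ g′ k) →
  ∀ k → HasSummand u (f k) (f′ k) → HasSummand v (g 0) (g′ 0) →
  HasSummand (u *ᵀ v) ((f ⊛ g) k) ((f′ ⊛ g′) k)
summand-⊛ f⊴ g⊴ zero    hf hg = summand-* hf hg
summand-⊛ f⊴ g⊴ (suc k) hf hg =
  summand-+ʳ (*-⊴ (f⊴ 0) (g⊴ (suc k))) (summand-⊛ (f⊴ ∘ suc) g⊴ k hf hg)

δ⊴δ : ∀ {n} (i j : Fin n) → δ i j ⊴ δ i j
δ⊴δ i j with i Fin.≟ j
... | yes _ = unit⊴1 1ᵀ
... | no  _ = 0⊴0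

_⊴ᴹ_ : ∀ {n} → Matrix ℂ n → Matrix ℂ n → Set
M ⊴ᴹ N = ∀ i j → M i j ⊴ N i j

walks-⊴ : ∀ {n} {M N : Matrix ℂ (suc n)} → M ⊴ᴹ N → ∀ i k → walks M i k ⊴ walks N i k
walks-⊴ M⊴N i zero    = δ⊴δ zero i
walks-⊴ M⊴N i (suc k) = sum-⊴ _ _ λ l → *-⊴ (walks-⊴ M⊴N l k) (M⊴N l i)

complete-⊴ : ∀ n {M N : Matrix ℂ n} → M ⊴ᴹ N → ∀ k → complete n M k ⊴ complete n N k
complete-⊴ zero    M⊴N zero    = unit⊴1 1ᵀ
complete-⊴ zero    M⊴N (suc k) = 0⊴0
complete-⊴ (suc n) M⊴N = ⊛-⊴ (walks-⊴ M⊴N zero) (complete-⊴ n λ i j → M⊴N (suc i) (suc j))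

complete-0 : ∀ n (M : Matrix ℂ n) → complete n M 0 ≈ 1#
complete-0 zero    M = refl
complete-0 (suc n) M = trans (*-identityˡ _) (complete-0 n (deleteFirst M))

-- The remaining factors W(M′) W(M″) ⋯ have constant term 1, from walks of length 0. Each unit in
-- the k-th coefficient of W(M) therefore occurs by itself in the k-th coefficient of the whole
-- product.
closedWalks-tight : ∀ {n u} {M N : Matrix ℂ (suc n)} → M ⊴ᴹ N → complete (suc n) M ≋ complete (suc n) N →
  ∀ k → HasSummand u (walks M zero k) (walks N zero k) → u ≈ᵀ 1ᵀ
closedWalks-tight {n} {u} {M} {N} M⊴N M≋N k h = trans (sym (*-identityʳ _)) (summand-tight
  (summand-⊛ {v = 1ᵀ} (walks-⊴ M⊴N zero) (complete-⊴ n λ i j → M⊴N (suc i) (suc j)) k h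
    (summand 0⊴0 (trans (complete-0 n _) (sym (+-identityʳ _)))
                 (trans (complete-0 n _) (sym (+-identityʳ _)))))
  (at M≋N k))

-- Gain digraphs

conj-inverseˡ : ∀ u → conjᵀ u *ᵀ u ≈ᵀ 1ᵀ
conj-inverseˡ u = mk≈ᶜ
  (≈ᴿ.trans (≗⇒≈ᴿ _ ∣ val u ∣² λ n → conj-product-re (seq (re (val u)) n) (seq (im (val u)) n)) (unit u))
  (≗⇒≈ᴿ _ 0ᴿ λ n → conj-product-im (seq (re (val u)) n) (seq (im (val u)) n))

conj-inverseʳ : ∀ u → u *ᵀ conjᵀ u ≈ᵀ 1ᵀ
conj-inverseʳ u = trans (*-comm _ _) (conj-inverseˡ u)

-- Invariance under diagonal similarity

module _ {n} (A B : Matrix ℂ n) (ψ : Fin n → 𝕋) where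

  DiagonallySimilar : Set
  DiagonallySimilar = ∀ i j → A i j ≈ val (conjᵀ (ψ i)) * (B i j * val (ψ j))

walks-similar : ∀ {n} {A B : Matrix ℂ (suc n)} ψ → DiagonallySimilar A B ψ → ∀ i k →
  walks A i k ≈ (val (conjᵀ (ψ zero)) * val (ψ i)) * walks B i k
walks-similar ψ A~B zero    zero    = sym (trans (*-identityʳ _) (conj-inverseˡ (ψ zero)))
walks-similar ψ A~B (suc i) zero    = sym (zeroʳ _)
walks-similar {A = A} {B} ψ A~B i (suc k) = begin
  (sum λ l → walks A l k * A l i)
    ≈⟨ sum-cong-≋ (λ l → begin
         walks A l k * A l i
           ≈⟨ *-cong (walks-similar ψ A~B l k) (A~B l i) ⟩
         ((c zero * p l) * walks B l k) * (c l * (B l i * p i))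
           ≈⟨ rearrange (c zero) (p l) (walks B l k) (c l) (B l i) (p i) ⟩
         (p l * c l) * ((c zero * p i) * (walks B l k * B l i))
           ≈⟨ trans (*-congʳ (conj-inverseʳ (ψ l))) (*-identityˡ _) ⟩
         (c zero * p i) * (walks B l k * B l i) ∎) ⟩
  (sum λ l → (c zero * p i) * (walks B l k * B l i))
    ≈⟨ sym (*-distribˡ-sum (c zero * p i) (λ l → walks B l k * B l i)) ⟩
  (c zero * p i) * walks B i (suc k) ∎
  where
  p c : _ → ℂ
  p l = val (ψ l)
  c l = val (conjᵀ (ψ l))
  rearrange : ∀ a b x y z w → ((a * b) * x) * (y * (z * w)) ≈ (b * y) * ((a * w) * (x * z))
  rearrange = solve 6 (λ a b x y z w →
    ((a :* b) :* x) :* (y :* (z :* w)) := (b :* y) :* ((a :* w) :* (x :* z))) refl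

-- This replaces the usual argument by multiplicativity of the determinant. Conjugation by a
-- diagonal matrix preserves the weights of closed walks, and it restricts to the principal
-- submatrix left after deleting a vertex, so every factor of the product is preserved.
complete-similar : ∀ n {A B : Matrix ℂ n} ψ → DiagonallySimilar A B ψ → ∀ k →
  complete n A k ≈ complete n B k
complete-similar zero    ψ A~B k = refl
complete-similar (suc n) ψ A~B = ⊛-cong
  (λ k → trans (walks-similar ψ A~B zero k) (trans (*-congʳ (conj-inverseˡ (ψ zero))) (*-identityˡ _)))
  (complete-similar n (ψ ∘ suc) λ i j → A~B (suc i) (suc j))

-- Potentials, switching and cycle balance

module _ {n} {D : Digraph n} where

  open DecMembership (Fin._≟_ {n}) using (_∈?_)

  adjacency-arc : ∀ {i j} → Arc D i j → adjacencyMatrix D i j ≡ 1#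
  adjacency-arc {i} {j} arc with adjacent D i j
  ... | true = ≡.refl

  adjacency-nonArc : ∀ {i j} → ¬ Arc D i j → adjacencyMatrix D i j ≡ 0#
  adjacency-nonArc {i} {j} ¬arc with adjacent D i j
  ... | true  = contradiction tt ¬arc
  ... | false = ≡.refl

  target∈vertices : ∀ {i j} (w : Walk D i j) → j ∈ vertices D w
  target∈vertices nil     = here ≡.refl
  target∈vertices (_ ◅ w) = there (target∈vertices w)

  module _ (Φ : GainDigraph D) where

    gainMatrix-arc : ∀ {i j} (arc : Arc D i j) → gainMatrix Φ i j ≡ val (gain Φ i j arc)
    gainMatrix-arc {i} {j} arc with T? (adjacent D i j)
    ... | yes arc′ = ≡.cong (val ∘ gain Φ i j) (T-irrelevant arc′ arc)
    ... | no  ¬arc = contradiction arc ¬arc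

    walkGain-◅◅ : ∀ {i j k} (v : Walk D i j) (w : Walk D j k) →
      walkGain Φ (v ◅◅ w) ≈ᵀ walkGain Φ v *ᵀ walkGain Φ w
    walkGain-◅◅ nil     w = sym (*-identityˡ _)
    walkGain-◅◅ (_ ◅ v) w = trans (*-congˡ (walkGain-◅◅ v w)) (sym (*-assoc _ _ _))

    potential⇒walkGain : ∀ ψ → IsPotential Φ ψ → ∀ {i j} (w : Walk D i j) →
      walkGain Φ w ≈ᵀ conjᵀ (ψ i) *ᵀ ψ j
    potential⇒walkGain ψ pot {i} nil = sym (conj-inverseˡ (ψ i))
    potential⇒walkGain ψ pot (_◅_ {i} {k} {j} arc w) = begin
      val (gain Φ i k arc) * val (walkGain Φ w)
        ≈⟨ *-cong (pot i k arc) (potential⇒walkGain ψ pot w) ⟩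
      (c i * p k) * (c k * p j)
        ≈⟨ rearrange (c i) (p k) (c k) (p j) ⟩
      (p k * c k) * (c i * p j)
        ≈⟨ trans (*-congʳ (conj-inverseʳ (ψ k))) (*-identityˡ _) ⟩
      c i * p j ∎
      where
      p c : Fin n → ℂ
      p l = val (ψ l)
      c l = val (conjᵀ (ψ l))
      rearrange : ∀ x y z w → (x * y) * (z * w) ≈ (y * z) * (x * w)
      rearrange = solve 4 (λ x y z w → (x :* y) :* (z :* w) := (y :* z) :* (x :* w)) refl

    potential⇒balanced : HasPotential Φ → CycleBalanced Φ
    potential⇒balanced (ψ , pot) C =
      trans (potential⇒walkGain ψ pot (Cycle.closedWalk C)) (conj-inverseˡ (ψ (Cycle.start C)))

    potential⇒similar : ∀ ψ → IsPotential Φ ψ →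
      DiagonallySimilar (gainMatrix Φ) (adjacencyMatrix D) ψ
    potential⇒similar ψ pot i j with T? (adjacent D i j)
    ... | yes arc = trans (pot i j arc) (*-congˡ (sym (trans
      (*-congʳ (reflexive (adjacency-arc arc))) (*-identityˡ _))))
    ... | no ¬arc = sym (trans (*-congˡ (trans
      (*-congʳ (reflexive (adjacency-nonArc ¬arc))) (zeroˡ _))) (zeroʳ _))

    potential⇒cospectral : HasPotential Φ → Cospectral (gainMatrix Φ) (adjacencyMatrix D)
    potential⇒cospectral (ψ , pot) = complete⇒charPoly (gainMatrix Φ) (adjacencyMatrix D)
      (pointwise (complete-similar n ψ (potential⇒similar ψ pot)))

    -- Solving 1 = σᵢ φᵢⱼ conj σⱼ for φᵢⱼ shows that the switching function is itself the potential.
    switching⇒potential : Φ ∼ trivialGain D → HasPotential Φ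
    switching⇒potential (σ , trivial≈) = σ , λ i j arc → begin
      g i j arc
        ≈⟨ sym (trans (*-cong (conj-inverseˡ (σ i)) (*-congˡ (conj-inverseˡ (σ j))))
             (trans (*-identityˡ _) (*-identityʳ _))) ⟩
      (c i * p i) * (g i j arc * (c j * p j))
        ≈⟨ rearrange (c i) (p i) (g i j arc) (c j) (p j) ⟩
      (c i * p j) * ((p i * g i j arc) * c j)
        ≈⟨ trans (*-congˡ (sym (trivial≈ i j arc))) (*-identityʳ _) ⟩
      c i * p j ∎
      where
      g : ∀ i j → Arc D i j → ℂ
      g i j arc = val (gain Φ i j arc)
      p c : Fin n → ℂ
      p l = val (σ l)
      c l = val (conjᵀ (σ l))
      rearrange : ∀ x y z w v → (x * y) * (z * (w * v)) ≈ (x * v) * ((y * z) * w)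
      rearrange = solve 5 (λ x y z w v → (x :* y) :* (z :* (w :* v)) := (x :* v) :* ((y :* z) :* w)) refl

    potential⇒switching : HasPotential Φ → Φ ∼ trivialGain D
    potential⇒switching (ψ , pot) = ψ , λ i j arc → sym (begin
      (p i * val (gain Φ i j arc)) * c j
        ≈⟨ *-congʳ (*-congˡ (pot i j arc)) ⟩
      (p i * (c i * p j)) * c j
        ≈⟨ rearrange (p i) (c i) (p j) (c j) ⟩
      (p i * c i) * (p j * c j)
        ≈⟨ trans (*-cong (conj-inverseʳ (ψ i)) (conj-inverseʳ (ψ j))) (*-identityˡ _) ⟩
      1# ∎)
      where
      p c : Fin n → ℂ
      p l = val (ψ l)
      c l = val (conjᵀ (ψ l))
      rearrange : ∀ x y z w → (x * (y * z)) * w ≈ (x * y) * (z * w)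
      rearrange = solve 4 (λ x y z w → (x :* (y :* z)) :* w := (x :* y) :* (z :* w)) refl

    BalancedAt : Fin n → Set
    BalancedAt r = ∀ (w : Walk D r r) → walkGain Φ w ≈ᵀ 1ᵀ

    balancedAt⇒potential : StronglyConnected D → ∀ r → BalancedAt r → HasPotential Φ
    balancedAt⇒potential connected r balanced = ψ , λ i j arc → begin
      val (gain Φ i j arc)
        ≈⟨ sym (trans (*-congʳ (conj-inverseˡ (ψ i))) (*-identityˡ _)) ⟩
      (c i * p i) * val (gain Φ i j arc)
        ≈⟨ *-assoc _ _ _ ⟩
      c i * (p i * val (gain Φ i j arc))
        ≈⟨ *-congˡ (advance i j arc) ⟩
      c i * p j ∎
      where
      to : ∀ j → Walk D r j
      to j = proj₁ (connected r j)
      back : ∀ j → Walk D j r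
      back j = proj₁ (connected j r)
      ψ : Fin n → 𝕋
      ψ j = walkGain Φ (to j)
      p c : Fin n → ℂ
      p l = val (ψ l)
      c l = val (conjᵀ (ψ l))
      -- Two closed walks at `r` share the return `back j`: one reaches j by `to j`, the other by
      -- `to i` and the arc. Both have gain 1, so their outward parts have equal gain.
      advance : ∀ i j arc → p i * val (gain Φ i j arc) ≈ p j
      advance i j arc = begin
        p i * g                ≈⟨ sym (*-identityʳ _) ⟩
        (p i * g) * 1#         ≈⟨ *-congˡ (sym (trans (sym (walkGain-◅◅ (to j) (back j)))
                                                      (balanced (to j ◅◅ back j)))) ⟩
        (p i * g) * (p j * b)  ≈⟨ rearrange (p i) g (p j) b ⟩
        (p i * (g * b)) * p j  ≈⟨ *-congʳ (trans (sym (walkGain-◅◅ (to i) (arc ◅ back j)))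
                                                 (balanced (to i ◅◅ arc ◅ back j))) ⟩
        1# * p j               ≈⟨ *-identityˡ _ ⟩
        p j ∎
        where
        g b : ℂ
        g = val (gain Φ i j arc)
        b = val (walkGain Φ (back j))
        rearrange : ∀ x y z w → (x * y) * (z * w) ≈ (x * (y * w)) * z
        rearrange = solve 4 (λ x y z w → (x :* y) :* (z :* w) := (x :* (y :* w)) :* z) refl

    -- A path cut at its vertex i. The uniqueness fields have the shape that loop erasure requires:
    -- an arc from i to k followed by `before` is a cycle, and `after` is a path. `before⊆` carries
    -- distinctness through the recursion.
    record Split {i k j} (p : Walk D k j) : Set where
      constructor split
      field
        before        : Walk D k i
        after         : Walk D i j
        gain-split    : walkGain Φ p ≈ᵀ walkGain Φ before *ᵀ walkGain Φ after
        before⊆       : ∀ {v} → All (v ≢_) (vertices D p) → All (v ≢_) (sources D before)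
        before-unique : Unique (i ∷ sources D before)
        after-unique  : Unique (vertices D after)

    splitPath : ∀ {i k j} (p : Walk D k j) → Unique (vertices D p) → i ∈ vertices D p → Split {i} p
    splitPath nil       unique (here ≡.refl) =
      split nil nil (sym (*-identityˡ _)) (λ _ → []) ([] ∷ []) unique
    splitPath (arc ◅ p) unique (here ≡.refl) =
      split nil (arc ◅ p) (sym (*-identityˡ _)) (λ _ → []) ([] ∷ []) unique
    splitPath (arc ◅ p) (k∉p ∷ unique) (there i∈p) with splitPath p unique i∈p
    ... | split before after eq before⊆ (i∉before ∷ before-unique) after-unique = split
      (arc ◅ before) after
      (trans (*-congˡ eq) (sym (*-assoc _ _ _)))
      (λ { (v≢k ∷ v∉p) → v≢k ∷ before⊆ v∉p })
      (((All.lookup k∉p i∈p ∘ ≡.sym) ∷ i∉before) ∷ before⊆ k∉p ∷ before-unique)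
      after-unique

    eraseLoops : CycleBalanced Φ → ∀ {i j} (w : Walk D i j) →
      ∃ λ ((p , _) : Path D i j) → walkGain Φ w ≈ᵀ walkGain Φ p
    eraseLoops balanced nil = (nil , [] ∷ []) , refl
    eraseLoops balanced (_◅_ {i} arc w) with eraseLoops balanced w
    ... | (p , unique) , w≈p with i ∈? vertices D p
    ...   | no  i∉p = (arc ◅ p , ¬Any⇒All¬ _ i∉p ∷ unique) , *-congˡ w≈p
    ...   | yes i∈p with splitPath p unique i∈p
    ...     | split before after eq _ before-unique after-unique =
      (after , after-unique) , trans (*-congˡ (trans w≈p eq)) (trans (sym (*-assoc _ _ _))
        (trans (*-congʳ (balanced (record { first = arc ; rest = before ; distinct = before-unique })))
          (*-identityˡ _)))

    -- Loop erasure turns a closed walk into a path from r to r. Such a path is empty, since its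
    -- first vertex would otherwise recur as its last.
    balanced⇒balancedAt : CycleBalanced Φ → ∀ r → BalancedAt r
    balanced⇒balancedAt balanced r w with eraseLoops balanced w
    ... | (nil , _)           , w≈p = w≈p
    ... | (_ ◅ p , r∉p ∷ _) , _   =
      contradiction ≡.refl (All.lookup r∉p (target∈vertices p))

    gainMatrix-⊴ : gainMatrix Φ ⊴ᴹ adjacencyMatrix D
    gainMatrix-⊴ i j with T? (adjacent D i j)
    ... | yes arc = ⊴-resp-≈ refl (reflexive (adjacency-arc arc)) (unit⊴1 (gain Φ i j arc))
    ... | no ¬arc = ⊴-resp-≈ refl (reflexive (adjacency-nonArc ¬arc)) 0⊴0

    gainMatrix-summand : ∀ {i j} (arc : Arc D i j) →
      HasSummand (gain Φ i j arc) (gainMatrix Φ i j) (adjacencyMatrix D i j)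
    gainMatrix-summand arc = summand 0⊴0
      (trans (reflexive (gainMatrix-arc arc)) (sym (+-identityʳ _)))
      (trans (reflexive (adjacency-arc arc)) (sym (+-identityʳ _)))

-- From cospectrality to a potential

-- `walks` grows at its right end while a `Walk` is consumed from the left, so the induction carries
-- the part already traversed: from vertex 0 to i, of length k and gain u. The final length stays
-- existential because tightness holds for every coefficient.
walkGain-summand : ∀ {n} {D : Digraph (suc n)} (Φ : GainDigraph D) {i j} (w : Walk D i j) {u} k →
  HasSummand u (walks (gainMatrix Φ) i k) (walks (adjacencyMatrix D) i k) →
  ∃ λ l → HasSummand (u *ᵀ walkGain Φ w) (walks (gainMatrix Φ) j l) (walks (adjacencyMatrix D) j l)
walkGain-summand Φ nil     k h = k , summand-resp-≈ (sym (*-identityʳ _)) h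
walkGain-summand Φ {i} (arc ◅ w) k h =
  let l , h′ = walkGain-summand Φ w (suc k) (summand-sum _ _
        (λ l → *-⊴ (walks-⊴ (gainMatrix-⊴ Φ) l k) (gainMatrix-⊴ Φ l _)) i
        (summand-* h (gainMatrix-summand Φ arc)))
  in l , summand-resp-≈ (*-assoc _ _ _) h′

cospectral⇒balancedAt : ∀ {n} {D : Digraph (suc n)} (Φ : GainDigraph D) →
  Cospectral (gainMatrix Φ) (adjacencyMatrix D) → BalancedAt Φ zero
cospectral⇒balancedAt {n} {D} Φ cospectral w =
  let k , h = walkGain-summand Φ w {1ᵀ} 0 (summand-unit 1ᵀ) in
  trans (sym (*-identityˡ _)) (closedWalks-tight (gainMatrix-⊴ Φ)
    (charPoly⇒complete (gainMatrix Φ) (adjacencyMatrix D) cospectral) k h)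

cospectral⇒potential : ∀ n {D : Digraph n} (Φ : GainDigraph D) → StronglyConnected D →
  Cospectral (gainMatrix Φ) (adjacencyMatrix D) → HasPotential Φ
cospectral⇒potential zero    Φ connected cospectral = (λ ()) , λ ()
cospectral⇒potential (suc n) Φ connected cospectral =
  balancedAt⇒potential Φ connected zero (cospectral⇒balancedAt Φ cospectral)

balanced⇒potential : ∀ n {D : Digraph n} (Φ : GainDigraph D) → StronglyConnected D →
  CycleBalanced Φ → HasPotential Φ
balanced⇒potential zero    Φ connected balanced = (λ ()) , λ ()
balanced⇒potential (suc n) Φ connected balanced =
  balancedAt⇒potential Φ connected zero (balanced⇒balancedAt Φ balanced zero)

theorem2p7 : ∀ (n : ℕ) (D : Digraph n) (Φ : GainDigraph D) → StronglyConnected D →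
    (CycleBalanced Φ ⇔ (Φ ∼ trivialGain D))
    × ((Φ ∼ trivialGain D) ⇔ HasPotential Φ)
    × ((Φ ∼ trivialGain D) ⇔ Cospectral (gainMatrix Φ) (adjacencyMatrix D))
theorem2p7 n D Φ connected =
    mk⇔ (potential⇒switching Φ ∘ balanced⇒potential n Φ connected)
        (potential⇒balanced Φ ∘ switching⇒potential Φ)
  , mk⇔ (switching⇒potential Φ) (potential⇒switching Φ)
  , mk⇔ (potential⇒cospectral Φ ∘ switching⇒potential Φ)
        (potential⇒switching Φ ∘ cospectral⇒potential n Φ connected)
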